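{- Let $\lambda$ be an uncountable cardinal and let $F$ be a field. Then there exists an $F$-algebra $R$ such that for any regular uncountable cardinal $\kappa \leq \lambda$ and any $i \in B(\kappa)$ there is a strongly uniform right $R$-module $L$ (of dimension $\kappa$) such that $\mathrm{End}_R(L) = F$ and $\Gamma(L) = i$. In particular, for every regular uncountable cardinal $\kappa\le\lambda$, the $\kappa$-spectrum $\mathrm{Spec}_\Gamma(\kappa,R)$ is full.
   Context: Rings are associative with unit; modules are unitary right modules. $\mathrm{End}_R(L)=F$ means that the $R$-endomorphisms of $L$ are exactly the multiplications by scalars of $F$. For a regular uncountable cardinal $\kappa$, $B(\kappa)$ is the Boolean algebra of all subsets of $\kappa$ modulo the club filter: for $E\subseteq\kappa$, $\bar E=\overline{E}$ is the class of all $D\subseteq\kappa$ with $D\cap C=E\cap C$ for some closed unbounded $C\subseteq\kappa$. Let $U$ be a module. A c.d.c. of length $\kappa$ ($\kappa$ an ordinal) in $U$ is a sequence $\mathcal U=(U_\alpha\mid\alpha<\kappa)$ of non-zero submodules of $U$ that is continuous ($U_0=U$, and $U_\alpha=\bigcap_{\beta<\alpha}U_\beta$ for limit $\alpha<\kappa$), strictly decreasing ($U_{\alpha+1}\subsetneq U_\alpha$), and cofinal (each non-zero submodule of $U$ contains some $U_\alpha$). $U$ is strongly uniform if there is a c.d.c. in $U$; the dimension of $U$ is the least length of a c.d.c. in $U$. For submodules $0\ne V\subsetneq W\subseteq U$, $W$ is complemented over $V$ (in $U$) if there is a submodule $X\subseteq U$ with $W\cap X=V$ and $W+X=U$. If $U$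 is strongly uniform of dimension $\kappa$, a regular uncountable cardinal, and $\mathcal U=(U_\alpha\mid\alpha<\kappa)$ is a c.d.c. in $U$, put $$E_{\mathcal U}=\{\alpha<\kappa\mid \exists\beta:\ \alpha<\beta<\kappa \text{ and } U_\alpha \text{ is not complemented over } U_\beta\}$$ and $\Gamma(U)=\overline{E_{\mathcal U}}\in B(\kappa)$; this does not depend on the choice of $\mathcal U$ (known fact). $\mathrm{Spec}_\Gamma(\kappa,R)$ is the set of all $i\in B(\kappa)$ such that $i=\Gamma(U)$ for some strongly uniform right $R$-module $U$ of dimension $\kappa$; it is full if it equals $B(\kappa)$. -}

module Defs where

open import Algebra.Bundles using (CommutativeRing; Ring)
open import Algebra.Module.Bundles using (RightModule)
open import Algebra.Module.Morphism.Structures using (module RightModuleMorphisms)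
open import Algebra.Morphism.Structures using (module RingMorphisms)
open import Data.Nat.Base using (ℕ)
open import Data.Product using (Σ-syntax; ∃-syntax; _×_; proj₁)
open import Function.Bundles using (Func; Injection; Surjection; Bijection; _⇔_)
open import Induction.WellFounded using (WellFounded)
open import Level using (Level; suc; _⊔_)
open import Relation.Binary.Bundles using (Setoid)
open import Relation.Binary.Core using (Rel)
open import Relation.Binary.Structures using (IsStrictTotalOrder)
open import Relation.Binary.PropositionalEquality using (_≡_; setoid)
open import Relation.Nullary using (¬_)
open import Relation.Unary using (Pred; _∈_; _⊆_; _⊂_; _≐_; _∩_)
import Relation.Binary.Construct.On as On

-- Choice in its extensional form: every surjection of setoids has a section
-- that respects the setoid equalities.  (Without "respects", it would be
-- provable outright from the stdlib definition of surjectivity.)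
AxiomOfChoice : ∀ a b c d → Set (suc (a ⊔ b ⊔ c ⊔ d))
AxiomOfChoice a b c d =
  (S : Setoid a b) (T : Setoid c d) (f : Surjection S T) →
  Σ[ g ∈ Func T S ] (∀ y → Setoid._≈_ T (Surjection.to f (Func.to g y)) y)

------------------------------------------------------------------------
-- Ordinals and cardinals

-- Ordinals are represented by well-ordered types; the ordinals below a given
-- one are its elements.
record Ordinal (ℓ : Level) : Set (suc ℓ) where
  infix 4 _<_
  field
    Carrier            : Set ℓ
    _<_                : Rel Carrier ℓ
    isStrictTotalOrder : IsStrictTotalOrder _≡_ _<_
    <-wellFounded      : WellFounded _<_

  underlying : Setoid ℓ ℓ
  underlying = setoid Carrier

  -- Equality of elements of {β | β < α} ignores the proofs of β < α.
  segment : Carrier → Setoid ℓ ℓ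
  segment α = On.setoid underlying (proj₁ {B = λ β → β < α})

  IsLeast : Carrier → Set ℓ
  IsLeast α = ∀ β → ¬ (β < α)

  IsSuccessor : Carrier → Carrier → Set ℓ
  IsSuccessor α α⁺ = α < α⁺ × (∀ γ → ¬ (α < γ × γ < α⁺))

  IsLimit : Carrier → Set ℓ
  IsLimit α = (∃[ β ] β < α) × (∀ β → β < α → ∃[ γ ] (β < γ × γ < α))

  -- The subsets of the ordinal; elements of B(κ) are given by representatives.
  Subset : Set (suc ℓ)
  Subset = Pred Carrier ℓ

  Unbounded : Subset → Set ℓ
  Unbounded C = ∀ β → ∃[ γ ] (γ ∈ C × β < γ)

  Closed : Subset → Set ℓ
  Closed C = ∀ α → IsLimit α →
    (∀ β → β < α → ∃[ γ ] (γ ∈ C × β < γ × γ < α)) → α ∈ C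

  IsClub : Subset → Set ℓ
  IsClub C = Closed C × Unbounded C

  -- Equality in B(κ).  The levels may differ because the set attached to a
  -- chain of submodules is defined by quantifying over all submodules.
  infix 4 _≈ᴮ_
  _≈ᴮ_ : ∀ {p q} → Pred Carrier p → Pred Carrier q → Set (suc ℓ ⊔ p ⊔ q)
  D ≈ᴮ E = Σ[ C ∈ Subset ] (IsClub C × (D ∩ C) ≐ (E ∩ C))

-- Comparison of ordinals: α is at most β iff there is a strictly increasing
-- map from α to β.
infix 4 _≤ₒ_
_≤ₒ_ : ∀ {ℓ} → Ordinal ℓ → Ordinal ℓ → Set ℓ
α ≤ₒ β = Σ[ f ∈ (A.Carrier → B.Carrier) ] (∀ x y → x A.< y → f x B.< f y)
  where
  module A = Ordinal α
  module B = Ordinal β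

module _ {ℓ : Level} (κ : Ordinal ℓ) where
  open Ordinal κ

  -- Cardinals are initial ordinals.
  IsCardinal : Set ℓ
  IsCardinal = ∀ α → ¬ Bijection (segment α) underlying

  IsUncountable : Set ℓ
  IsUncountable = ¬ Injection underlying (setoid ℕ)

  Cofinal : ∀ {α} → Func (segment α) underlying → Set ℓ
  Cofinal f = ∀ β → ∃[ x ] ¬ (Func.to f x < β)

  IsRegular : Set ℓ
  IsRegular = ∀ α (f : Func (segment α) underlying) → ¬ Cofinal f

  record IsRegularUncountableCardinal : Set ℓ where
    field
      isCardinal    : IsCardinal
      isUncountable : IsUncountable
      isRegular     : IsRegular

infix 4 _≤ᶜ_
_≤ᶜ_ : ∀ {ℓ} → Ordinal ℓ → Ordinal ℓ → Set ℓ
κ ≤ᶜ μ = Injection (Ordinal.underlying κ) (Ordinal.underlying μ)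

------------------------------------------------------------------------
-- Fields and algebras

record Field (ℓ : Level) : Set (suc ℓ) where
  field
    commutativeRing : CommutativeRing ℓ ℓ

  open CommutativeRing commutativeRing public

  field
    1≉0     : ¬ (1# ≈ 0#)
    inverse : ∀ x → ¬ (x ≈ 0#) → ∃[ y ] x * y ≈ 1#

record FAlgebra {ℓ : Level} (F : Field ℓ) : Set (suc ℓ) where
  private module F = Field F

  field
    ring : Ring ℓ ℓ

  open Ring ring public

  open RingMorphisms F.rawRing rawRing using (IsRingHomomorphism)

  field
    ι                    : F.Carrier → Carrier
    ι-isRingHomomorphism : IsRingHomomorphism ι
    ι-central            : ∀ a r → ι a * r ≈ r * ι a

------------------------------------------------------------------------
-- Strongly uniform modules

module _ {ℓ : Level} {R : Ring ℓ ℓ} (M : RightModule R ℓ ℓ) where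
  open RightModule M

  record Submodule : Set (suc ℓ) where
    field
      member    : Pred Carrierᴹ ℓ
      ≈-closed  : ∀ {x y} → x ≈ᴹ y → x ∈ member → y ∈ member
      0-closed  : 0ᴹ ∈ member
      +-closed  : ∀ {x y} → x ∈ member → y ∈ member → x +ᴹ y ∈ member
      *ᵣ-closed : ∀ {x} r → x ∈ member → x *ᵣ r ∈ member

  open Submodule

  NonZero : Submodule → Set ℓ
  NonZero V = ∃[ x ] (x ∈ member V × ¬ (x ≈ᴹ 0ᴹ))

  ComplementedOver : Submodule → Submodule → Set (suc ℓ)
  ComplementedOver W V = Σ[ X ∈ Submodule ]
    ( (member W ∩ member X) ≐ member V
    × (∀ u → ∃[ w ] ∃[ x ] (w ∈ member W × x ∈ member X × u ≈ᴹ w +ᴹ x)))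

  record CDC (κ : Ordinal ℓ) : Set (suc ℓ) where
    open Ordinal κ
    field
      U          : Carrier → Submodule
      nonZero    : ∀ α → NonZero (U α)
      start      : ∀ α → IsLeast α → ∀ x → x ∈ member (U α)
      continuous : ∀ α → IsLimit α →
                   member (U α) ≐ (λ x → ∀ β → β < α → x ∈ member (U β))
      decreasing : ∀ α α⁺ → IsSuccessor α α⁺ → member (U α⁺) ⊂ member (U α)
      cofinal    : ∀ V → NonZero V → ∃[ α ] member (U α) ⊆ member V

    NonComplemented : Pred Carrier (suc ℓ)
    NonComplemented α = ∃[ β ] (α < β × ¬ ComplementedOver (U α) (U β))

  StronglyUniform : Set (suc ℓ)
  StronglyUniform = Σ[ μ ∈ Ordinal ℓ ] CDC μ

  HasDimension : Ordinal ℓ → Set (suc ℓ)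
  HasDimension κ = CDC κ × (∀ μ → CDC μ → κ ≤ₒ μ)

  -- Γ(M) is the class of E in B(κ), for M strongly uniform of dimension κ.
  -- Γ(M) is computed by any chain, so this is required of all of them.
  Γ≡ : (κ : Ordinal ℓ) → Ordinal.Subset κ → Set (suc ℓ)
  Γ≡ κ E = (𝒰 : CDC κ) → Ordinal._≈ᴮ_ κ (CDC.NonComplemented 𝒰) E

module _ {ℓ : Level} {F : Field ℓ} (R : FAlgebra F) where
  private
    module F = Field F
    module R = FAlgebra R

  EndIsScalars : RightModule R.ring ℓ ℓ → Set ℓ
  EndIsScalars M = (φ : Carrierᴹ → Carrierᴹ) →
    IsRightModuleHomomorphism φ ⇔ (Σ[ a ∈ F.Carrier ] (∀ x → φ x ≈ᴹ x *ᵣ R.ι a))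
    where
    open RightModule M
    open RightModuleMorphisms rawRightModule rawRightModule
      using (IsRightModuleHomomorphism)

SpecΓ : ∀ {ℓ} (κ : Ordinal ℓ) → Ring ℓ ℓ → Pred (Ordinal.Subset κ) (suc ℓ)
SpecΓ {ℓ} κ R E = Σ[ M ∈ RightModule R ℓ ℓ ]
  (StronglyUniform M × HasDimension M κ × Γ≡ M κ E)

SpecΓ-Full : ∀ {ℓ} → Ordinal ℓ → Ring ℓ ℓ → Set (suc ℓ)
SpecΓ-Full κ R = ∀ E → E ∈ SpecΓ κ R

{-# OPTIONS --safe #-}
module Submission where

-- R is the free F-algebra on the set of all endomorphisms of one vector space
-- L, the space on the words over Λ × Λ.  Given κ and E, each element f of L is
-- viewed as a function ν ↦ p ν f on κ which is finitely piecewise constant and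
-- eventually equal to f itself; U α consists of the f vanishing on [0, α).  A
-- generator of R acts as the endomorphism it names if that preserves every U α
-- and, for α ∉ E, every X α γ = {f | f = 0 on [α, γ)}, and as 0 otherwise.
--
-- For α ∉ E, X α β complements U α over U β, because any f can be cut to its
-- part on [α, β), modulo U β.  If α ∈ E is a limit, R contains an operator T
-- with image in U α whose value at α is given by the left limit of its
-- argument at α.  Then T applied to a complement X of U α over U (α + 1) lands
-- in X ∩ U α = U (α + 1), while T kills the value at α of U α; as T does not
-- kill that of L = U α + X, there is no such X.
--
-- Given x ∈ L, a functional c and a large enough β, R contains for each
-- y ∈ U β an operator sending x to c(x) y.  So a non-zero submodule contains
-- some U β, and an endomorphism f satisfies c(x) f(y) = c(f(x)) y, which
-- forces it to be a scalar.
--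
-- Two chains of length κ agree on a club of limit ordinals, which makes Γ
-- independent of the chain, and regularity of κ makes its length minimal.

open import Defs
open import Algebra.Bundles using (CommutativeMonoid; Ring)
open import Algebra.Module.Bundles using (RightModule)
open import Algebra.Module.Morphism.Structures using (module RightModuleMorphisms)
import Algebra.Properties.CommutativeSemigroup as CommutativeSemigroupProperties
import Algebra.Properties.Ring as RingProperties
open import Axiom.ExcludedMiddle using (ExcludedMiddle)
open import Data.Bool.Base using (if_then_else_)
open import Data.List.Base using (List; []; _∷_; _++_)
open import Data.List.Relation.Unary.All as ListAll using (All; []; _∷_)
open import Data.Nat.Base as ℕ using (ℕ; _<′_; ≤′-reflexive; ≤′-step)
import Data.Nat.Properties as ℕₚ
open import Data.Product using (Σ; Σ-syntax; ∃-syntax; _×_; _,_; proj₁; proj₂)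
open import Data.Unit.Polymorphic.Base using (⊤; tt)
open import Data.Sum.Base using (_⊎_; inj₁; inj₂)
open import Function.Bundles using (Func; Injection; mk⇔)
import Induction.WellFounded as WF
open import Level using (_⊔_)
open import Relation.Binary.Bundles using (Setoid)
open import Relation.Binary.Definitions using (tri<; tri≈; tri>)
open import Relation.Binary.PropositionalEquality using (_≡_; refl; sym; trans; cong; subst)
import Relation.Binary.Reasoning.Setoid as SetoidReasoning
open import Relation.Binary.Structures using (IsStrictTotalOrder)
open import Relation.Nullary using (¬_; Dec; yes; no; does; contradiction)
open import Relation.Nullary.Decidable using (decidable-stable; dec-true; dec-false)
open import Relation.Unary using (Pred; _∈_; _⊆_; _≐_; _∩_)

-- Vector spaces of formal sums and linear extension.

module FormalSums {ℓ} (F : Field ℓ) (B : Set ℓ) where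
  open Field F public using (_≈_; _+_; _*_; -_; 0#; 1#) renaming (Carrier to K)
  private
    module F = Field F
    open RingProperties F.ring using (-1*x≈-x)
    open CommutativeSemigroupProperties
      (CommutativeMonoid.commutativeSemigroup F.+-commutativeMonoid) using (interchange)
    open SetoidReasoning F.setoid

  L : Set ℓ
  L = List (K × B)

  ⟪_∣_⟫ : L → (B → K) → K
  ⟪ []          ∣ φ ⟫ = 0#
  ⟪ (a , b) ∷ x ∣ φ ⟫ = a * φ b + ⟪ x ∣ φ ⟫

  -- Formal sums are identified when every functional agrees on them; this
  -- makes linear extension respect equality without any choice of normal form.
  infix 4 _≋_
  record _≋_ (x y : L) : Set ℓ where
    constructor ≋-by
    field
      pairing : ∀ φ → ⟪ x ∣ φ ⟫ ≈ ⟪ y ∣ φ ⟫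
  open _≋_ public

  infixr 7 _·_
  _·_ : K → L → L
  a · []            = []
  a · ((c , b) ∷ x) = (a * c , b) ∷ (a · x)

  basis : B → L
  basis b = (1# , b) ∷ []

  ext : (B → L) → L → L
  ext h []            = []
  ext h ((a , b) ∷ x) = a · h b ++ ext h x

  pair-congʳ : ∀ x {φ ψ} → (∀ b → φ b ≈ ψ b) → ⟪ x ∣ φ ⟫ ≈ ⟪ x ∣ ψ ⟫
  pair-congʳ []            eq = F.refl
  pair-congʳ ((a , b) ∷ x) eq = F.+-cong (F.*-congˡ (eq b)) (pair-congʳ x eq)

  pair-++ : ∀ x y φ → ⟪ x ++ y ∣ φ ⟫ ≈ ⟪ x ∣ φ ⟫ + ⟪ y ∣ φ ⟫
  pair-++ []            y φ = F.sym (F.+-identityˡ _)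
  pair-++ ((a , b) ∷ x) y φ =
    F.trans (F.+-congˡ (pair-++ x y φ)) (F.sym (F.+-assoc _ _ _))

  pair-· : ∀ a x φ → ⟪ a · x ∣ φ ⟫ ≈ a * ⟪ x ∣ φ ⟫
  pair-· a []            φ = F.sym (F.zeroʳ a)
  pair-· a ((c , b) ∷ x) φ =
    F.trans (F.+-cong (F.*-assoc a c (φ b)) (pair-· a x φ)) (F.sym (F.distribˡ _ _ _))

  pair-basis : ∀ b φ → ⟪ basis b ∣ φ ⟫ ≈ φ b
  pair-basis b φ = F.trans (F.+-identityʳ _) (F.*-identityˡ _)

  -- A functional pulls back along `h` to a functional on `B`. This reduces the laws of `ext` to
  -- identities in the field.
  pair-ext : ∀ h x φ → ⟪ ext h x ∣ φ ⟫ ≈ ⟪ x ∣ (λ b → ⟪ h b ∣ φ ⟫) ⟫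
  pair-ext h []            φ = F.refl
  pair-ext h ((a , b) ∷ x) φ =
    F.trans (pair-++ (a · h b) (ext h x) φ) (F.+-cong (pair-· a (h b) φ) (pair-ext h x φ))

  pair-0ʳ : ∀ x → ⟪ x ∣ (λ _ → 0#) ⟫ ≈ 0#
  pair-0ʳ []            = F.refl
  pair-0ʳ ((a , b) ∷ x) =
    F.trans (F.+-cong (F.zeroʳ a) (pair-0ʳ x)) (F.+-identityˡ _)

  pair-+ʳ : ∀ x φ ψ → ⟪ x ∣ (λ b → φ b + ψ b) ⟫ ≈ ⟪ x ∣ φ ⟫ + ⟪ x ∣ ψ ⟫
  pair-+ʳ []            φ ψ = F.sym (F.+-identityˡ _)
  pair-+ʳ ((a , b) ∷ x) φ ψ =
    F.trans (F.+-cong (F.distribˡ a _ _) (pair-+ʳ x φ ψ)) (interchange _ _ _ _)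

  pair-*ʳ : ∀ x a φ → ⟪ x ∣ (λ b → a * φ b) ⟫ ≈ a * ⟪ x ∣ φ ⟫
  pair-*ʳ []            a φ = F.sym (F.zeroʳ a)
  pair-*ʳ ((c , b) ∷ x) a φ = begin
    c * (a * φ b) + ⟪ x ∣ (λ b → a * φ b) ⟫ ≈⟨ F.+-cong (F.*-assoc c a _) (F.sym (pair-*ʳ x a φ)) ⟨
    (c * a) * φ b + a * ⟪ x ∣ φ ⟫           ≈⟨ F.+-congʳ (F.*-congʳ (F.*-comm c a)) ⟩
    (a * c) * φ b + a * ⟪ x ∣ φ ⟫           ≈⟨ F.+-congʳ (F.*-assoc a c _) ⟩
    a * (c * φ b) + a * ⟪ x ∣ φ ⟫           ≈⟨ F.distribˡ a _ _ ⟨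
    a * (c * φ b + ⟪ x ∣ φ ⟫)               ∎

  ≋-refl : ∀ {x} → x ≋ x
  ≋-refl = ≋-by λ φ → F.refl

  ≋-sym : ∀ {x y} → x ≋ y → y ≋ x
  ≋-sym p = ≋-by λ φ → F.sym (pairing p φ)

  ≋-trans : ∀ {x y z} → x ≋ y → y ≋ z → x ≋ z
  ≋-trans p q = ≋-by λ φ → F.trans (pairing p φ) (pairing q φ)

  ≋-setoid : Setoid ℓ ℓ
  ≋-setoid = record
    { _≈_ = _≋_
    ; isEquivalence = record { refl = ≋-refl ; sym = ≋-sym ; trans = ≋-trans } }

  ++-cong : ∀ {x x′ y y′} → x ≋ x′ → y ≋ y′ → x ++ y ≋ x′ ++ y′
  ++-cong {x} {x′} {y} {y′} p q = ≋-by λ φ → begin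
    ⟪ x ++ y ∣ φ ⟫            ≈⟨ pair-++ x y φ ⟩
    ⟪ x ∣ φ ⟫ + ⟪ y ∣ φ ⟫     ≈⟨ F.+-cong (pairing p φ) (pairing q φ) ⟩
    ⟪ x′ ∣ φ ⟫ + ⟪ y′ ∣ φ ⟫   ≈⟨ pair-++ x′ y′ φ ⟨
    ⟪ x′ ++ y′ ∣ φ ⟫          ∎

  ++-assoc : ∀ x y z → (x ++ y) ++ z ≋ x ++ (y ++ z)
  ++-assoc x y z = ≋-by λ φ → begin
    ⟪ (x ++ y) ++ z ∣ φ ⟫                   ≈⟨ pair-++ (x ++ y) z φ ⟩
    ⟪ x ++ y ∣ φ ⟫ + ⟪ z ∣ φ ⟫              ≈⟨ F.+-congʳ (pair-++ x y φ) ⟩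
    (⟪ x ∣ φ ⟫ + ⟪ y ∣ φ ⟫) + ⟪ z ∣ φ ⟫     ≈⟨ F.+-assoc _ _ _ ⟩
    ⟪ x ∣ φ ⟫ + (⟪ y ∣ φ ⟫ + ⟪ z ∣ φ ⟫)     ≈⟨ F.+-congˡ (pair-++ y z φ) ⟨
    ⟪ x ∣ φ ⟫ + ⟪ y ++ z ∣ φ ⟫              ≈⟨ pair-++ x (y ++ z) φ ⟨
    ⟪ x ++ (y ++ z) ∣ φ ⟫                   ∎

  ++-comm : ∀ x y → x ++ y ≋ y ++ x
  ++-comm x y = ≋-by λ φ → begin
    ⟪ x ++ y ∣ φ ⟫         ≈⟨ pair-++ x y φ ⟩
    ⟪ x ∣ φ ⟫ + ⟪ y ∣ φ ⟫  ≈⟨ F.+-comm _ _ ⟩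
    ⟪ y ∣ φ ⟫ + ⟪ x ∣ φ ⟫  ≈⟨ pair-++ y x φ ⟨
    ⟪ y ++ x ∣ φ ⟫         ∎

  ++-identityʳ : ∀ x → x ++ [] ≋ x
  ++-identityʳ x = ++-comm x []

  ·-cong : ∀ {a c x y} → a ≈ c → x ≋ y → a · x ≋ c · y
  ·-cong {a} {c} {x} {y} p q = ≋-by λ φ →
    F.trans (pair-· a x φ) (F.trans (F.*-cong p (pairing q φ)) (F.sym (pair-· c y φ)))

  0·x≋0 : ∀ {a} x → a ≈ 0# → a · x ≋ []
  0·x≋0 {a} x p = ≋-by λ φ → F.trans (pair-· a x φ) (F.trans (F.*-congʳ p) (F.zeroˡ _))

  1·x≋x : ∀ {a} x → a ≈ 1# → a · x ≋ x
  1·x≋x {a} x p = ≋-by λ φ → F.trans (pair-· a x φ) (F.trans (F.*-congʳ p) (F.*-identityˡ _))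

  ·-assoc : ∀ a c x → a · (c · x) ≋ (a * c) · x
  ·-assoc a c x = ≋-by λ φ → begin
    ⟪ a · (c · x) ∣ φ ⟫  ≈⟨ pair-· a (c · x) φ ⟩
    a * ⟪ c · x ∣ φ ⟫    ≈⟨ F.*-congˡ (pair-· c x φ) ⟩
    a * (c * ⟪ x ∣ φ ⟫)  ≈⟨ F.*-assoc a c _ ⟨
    (a * c) * ⟪ x ∣ φ ⟫  ≈⟨ pair-· (a * c) x φ ⟨
    ⟪ (a * c) · x ∣ φ ⟫  ∎

  ·-distribʳ : ∀ a c x → (a + c) · x ≋ a · x ++ c · x
  ·-distribʳ a c x = ≋-by λ φ → begin
    ⟪ (a + c) · x ∣ φ ⟫                ≈⟨ pair-· (a + c) x φ ⟩
    (a + c) * ⟪ x ∣ φ ⟫                ≈⟨ F.distribʳ _ a c ⟩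
    a * ⟪ x ∣ φ ⟫ + c * ⟪ x ∣ φ ⟫      ≈⟨ F.+-cong (pair-· a x φ) (pair-· c x φ) ⟨
    ⟪ a · x ∣ φ ⟫ + ⟪ c · x ∣ φ ⟫      ≈⟨ pair-++ (a · x) (c · x) φ ⟨
    ⟪ a · x ++ c · x ∣ φ ⟫             ∎

  neg : L → L
  neg x = (- 1#) · x

  neg-inverseʳ : ∀ x → x ++ neg x ≋ []
  neg-inverseʳ x = ≋-by λ φ → begin
    ⟪ x ++ neg x ∣ φ ⟫                ≈⟨ pair-++ x (neg x) φ ⟩
    ⟪ x ∣ φ ⟫ + ⟪ neg x ∣ φ ⟫         ≈⟨ F.+-congˡ (pair-· (- 1#) x φ) ⟩
    ⟪ x ∣ φ ⟫ + (- 1#) * ⟪ x ∣ φ ⟫    ≈⟨ F.+-congˡ (-1*x≈-x _) ⟩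
    ⟪ x ∣ φ ⟫ + - ⟪ x ∣ φ ⟫           ≈⟨ F.-‿inverseʳ _ ⟩
    0#                                ∎

  ext-cong : ∀ {g h x y} → (∀ b → g b ≋ h b) → x ≋ y → ext g x ≋ ext h y
  ext-cong {g} {h} {x} {y} p q = ≋-by λ φ → begin
    ⟪ ext g x ∣ φ ⟫                ≈⟨ pair-ext g x φ ⟩
    ⟪ x ∣ (λ b → ⟪ g b ∣ φ ⟫) ⟫    ≈⟨ pair-congʳ x (λ b → pairing (p b) φ) ⟩
    ⟪ x ∣ (λ b → ⟪ h b ∣ φ ⟫) ⟫    ≈⟨ pairing q _ ⟩
    ⟪ y ∣ (λ b → ⟪ h b ∣ φ ⟫) ⟫    ≈⟨ pair-ext h y φ ⟨
    ⟪ ext h y ∣ φ ⟫                ∎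

  ext-congˡ : ∀ {g h} x → (∀ b → g b ≋ h b) → ext g x ≋ ext h x
  ext-congˡ x p = ext-cong {x = x} p ≋-refl

  ext-congʳ : ∀ g {x y} → x ≋ y → ext g x ≋ ext g y
  ext-congʳ g = ext-cong (λ b → ≋-refl)

  ext-basis : ∀ g b → ext g (basis b) ≋ g b
  ext-basis g b = ≋-trans (++-identityʳ _) (1·x≋x (g b) F.refl)

  basis-ext : ∀ x → ext basis x ≋ x
  basis-ext x = ≋-by λ φ →
    F.trans (pair-ext basis x φ) (pair-congʳ x (λ b → pair-basis b φ))

  ext-∘ : ∀ g h x → ext g (ext h x) ≋ ext (λ b → ext g (h b)) x
  ext-∘ g h x = ≋-by λ φ → begin
    ⟪ ext g (ext h x) ∣ φ ⟫                            ≈⟨ pair-ext g (ext h x) φ ⟩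
    ⟪ ext h x ∣ (λ b → ⟪ g b ∣ φ ⟫) ⟫                  ≈⟨ pair-ext h x _ ⟩
    ⟪ x ∣ (λ b → ⟪ h b ∣ (λ b → ⟪ g b ∣ φ ⟫) ⟫) ⟫      ≈⟨ pair-congʳ x (λ b → pair-ext g (h b) φ) ⟨
    ⟪ x ∣ (λ b → ⟪ ext g (h b) ∣ φ ⟫) ⟫                ≈⟨ pair-ext _ x φ ⟨
    ⟪ ext (λ b → ext g (h b)) x ∣ φ ⟫                  ∎

  ext-++ : ∀ g x y → ext g (x ++ y) ≋ ext g x ++ ext g y
  ext-++ g x y = ≋-by λ φ → begin
    ⟪ ext g (x ++ y) ∣ φ ⟫                   ≈⟨ pair-ext g (x ++ y) φ ⟩
    ⟪ x ++ y ∣ _ ⟫                           ≈⟨ pair-++ x y _ ⟩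
    ⟪ x ∣ _ ⟫ + ⟪ y ∣ _ ⟫                    ≈⟨ F.+-cong (pair-ext g x φ) (pair-ext g y φ) ⟨
    ⟪ ext g x ∣ φ ⟫ + ⟪ ext g y ∣ φ ⟫        ≈⟨ pair-++ (ext g x) _ φ ⟨
    ⟪ ext g x ++ ext g y ∣ φ ⟫               ∎

  ext-· : ∀ g a x → ext g (a · x) ≋ a · ext g x
  ext-· g a x = ≋-by λ φ → begin
    ⟪ ext g (a · x) ∣ φ ⟫    ≈⟨ pair-ext g (a · x) φ ⟩
    ⟪ a · x ∣ _ ⟫            ≈⟨ pair-· a x _ ⟩
    a * ⟪ x ∣ _ ⟫            ≈⟨ F.*-congˡ (pair-ext g x φ) ⟨
    a * ⟪ ext g x ∣ φ ⟫      ≈⟨ pair-· a (ext g x) φ ⟨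
    ⟪ a · ext g x ∣ φ ⟫      ∎

  ext-sum : ∀ g h x → ext (λ b → g b ++ h b) x ≋ ext g x ++ ext h x
  ext-sum g h x = ≋-by λ φ → begin
    ⟪ ext (λ b → g b ++ h b) x ∣ φ ⟫                      ≈⟨ pair-ext _ x φ ⟩
    ⟪ x ∣ (λ b → ⟪ g b ++ h b ∣ φ ⟫) ⟫                    ≈⟨ pair-congʳ x (λ b → pair-++ (g b) (h b) φ) ⟩
    ⟪ x ∣ (λ b → ⟪ g b ∣ φ ⟫ + ⟪ h b ∣ φ ⟫) ⟫             ≈⟨ pair-+ʳ x _ _ ⟩
    ⟪ x ∣ (λ b → ⟪ g b ∣ φ ⟫) ⟫ + ⟪ x ∣ (λ b → ⟪ h b ∣ φ ⟫) ⟫ ≈⟨ F.+-cong (pair-ext g x φ) (pair-ext h x φ) ⟨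
    ⟪ ext g x ∣ φ ⟫ + ⟪ ext h x ∣ φ ⟫                     ≈⟨ pair-++ (ext g x) _ φ ⟨
    ⟪ ext g x ++ ext h x ∣ φ ⟫                            ∎

  -- For maps that agree only on the words occurring in `x`, as with words that are fresh or
  -- separated.
  ext-cong-All : ∀ {g h x} → All (λ t → g (proj₂ t) ≋ h (proj₂ t)) x → ext g x ≋ ext h x
  ext-cong-All []       = ≋-refl
  ext-cong-All (p ∷ ps) = ++-cong (·-cong F.refl p) (ext-cong-All ps)

  ext-rank1 : ∀ c y x → ext (λ b → c b · y) x ≋ ⟪ x ∣ c ⟫ · y
  ext-rank1 c y []            = ≋-sym (0·x≋0 y F.refl)
  ext-rank1 c y ((a , b) ∷ x) = ≋-trans
    (++-cong (·-assoc a (c b) y) (ext-rank1 c y x))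
    (≋-sym (·-distribʳ (a * c b) ⟪ x ∣ c ⟫ y))

  ext-0 : ∀ g x → (∀ b → g b ≋ []) → ext g x ≋ []
  ext-0 g x p = ≋-by λ φ →
    F.trans (pair-ext g x φ) (F.trans (pair-congʳ x (λ b → pairing (p b) φ)) (pair-0ʳ x))

  -- Written with coefficient `a`, not as `a · basis b`, so that composing two scalars computes to
  -- the scalar of their product.
  scalar : K → B → L
  scalar a b = (a , b) ∷ []

  ext-scalar : ∀ a x → ext (scalar a) x ≋ a · x
  ext-scalar a x = ≋-by λ φ → begin
    ⟪ ext (scalar a) x ∣ φ ⟫            ≈⟨ pair-ext (scalar a) x φ ⟩
    ⟪ x ∣ (λ b → a * φ b + 0#) ⟫        ≈⟨ pair-congʳ x (λ b → F.+-identityʳ _) ⟩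
    ⟪ x ∣ (λ b → a * φ b) ⟫             ≈⟨ pair-*ʳ x a φ ⟩
    a * ⟪ x ∣ φ ⟫                       ≈⟨ pair-· a x φ ⟨
    ⟪ a · x ∣ φ ⟫                       ∎

-- The free algebra, as terms modulo the algebra laws.

module FreeAlgebra {ℓ} (F : Field ℓ) (J : Set ℓ) where
  private module F = Field F

  infixl 6 _⊕_
  infixl 7 _⊛_
  data Term : Set ℓ where
    ι       : F.Carrier → Term
    gen     : J → Term
    _⊕_ _⊛_ : Term → Term → Term

  infix 4 _∼_
  data _∼_ : Term → Term → Set ℓ where
    ∼-refl    : ∀ {t} → t ∼ t
    ∼-sym     : ∀ {t u} → t ∼ u → u ∼ t
    ∼-trans   : ∀ {t u v} → t ∼ u → u ∼ v → t ∼ v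
    ⊕-cong    : ∀ {t t′ u u′} → t ∼ t′ → u ∼ u′ → t ⊕ u ∼ t′ ⊕ u′
    ⊛-cong    : ∀ {t t′ u u′} → t ∼ t′ → u ∼ u′ → t ⊛ u ∼ t′ ⊛ u′
    ⊕-assoc   : ∀ t u v → (t ⊕ u) ⊕ v ∼ t ⊕ (u ⊕ v)
    ⊕-comm    : ∀ t u → t ⊕ u ∼ u ⊕ t
    ⊕-idˡ     : ∀ t → ι F.0# ⊕ t ∼ t
    ⊛-assoc   : ∀ t u v → (t ⊛ u) ⊛ v ∼ t ⊛ (u ⊛ v)
    ⊛-idˡ     : ∀ t → ι F.1# ⊛ t ∼ t
    ⊛-zeroˡ   : ∀ t → ι F.0# ⊛ t ∼ ι F.0#
    distribˡ  : ∀ t u v → t ⊛ (u ⊕ v) ∼ t ⊛ u ⊕ t ⊛ v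
    distribʳ  : ∀ t u v → (u ⊕ v) ⊛ t ∼ u ⊛ t ⊕ v ⊛ t
    ι-cong    : ∀ {a b} → a F.≈ b → ι a ∼ ι b
    ι-+       : ∀ a b → ι (a F.+ b) ∼ ι a ⊕ ι b
    ι-*       : ∀ a b → ι (a F.* b) ∼ ι a ⊛ ι b
    ι-central : ∀ a t → ι a ⊛ t ∼ t ⊛ ι a

  ⊖_ : Term → Term
  ⊖ t = ι (F.- F.1#) ⊛ t

  ⊖-inverseʳ : ∀ t → t ⊕ ⊖ t ∼ ι F.0#
  ⊖-inverseʳ t =
    ∼-trans (⊕-cong (∼-sym (⊛-idˡ t)) ∼-refl)
    (∼-trans (∼-sym (distribʳ t _ _))
    (∼-trans (⊛-cong (∼-trans (∼-sym (ι-+ _ _)) (ι-cong (F.-‿inverseʳ F.1#))) ∼-refl)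
           (⊛-zeroˡ t)))

  ring : Ring ℓ ℓ
  ring = record
    { Carrier = Term ; _≈_ = _∼_ ; _+_ = _⊕_ ; _*_ = _⊛_ ; -_ = ⊖_
    ; 0# = ι F.0# ; 1# = ι F.1#
    ; isRing = record
      { +-isAbelianGroup = record
        { isGroup = record
          { isMonoid = record
            { isSemigroup = record
              { isMagma = record
                { isEquivalence = record { refl = ∼-refl ; sym = ∼-sym ; trans = ∼-trans }
                ; ∙-cong = ⊕-cong }
              ; assoc = ⊕-assoc }
            ; identity = ⊕-idˡ , λ t → ∼-trans (⊕-comm _ _) (⊕-idˡ t) }
          ; inverse = (λ t → ∼-trans (⊕-comm _ _) (⊖-inverseʳ t)) , ⊖-inverseʳ
          ; ⁻¹-cong = ⊛-cong ∼-refl }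
        ; comm = ⊕-comm }
      ; *-cong = ⊛-cong
      ; *-assoc = ⊛-assoc
      ; *-identity = ⊛-idˡ , λ t → ∼-trans (∼-sym (ι-central _ t)) (⊛-idˡ t)
      ; distrib = distribˡ , distribʳ } }

  algebra : FAlgebra F
  algebra = record
    { ring = ring
    ; ι = ι
    ; ι-isRingHomomorphism = record
      { isSemiringHomomorphism = record
        { isNearSemiringHomomorphism = record
          { +-isMonoidHomomorphism = record
            { isMagmaHomomorphism = record
              { isRelHomomorphism = record { cong = ι-cong }
              ; homo = ι-+ }
            ; ε-homo = ∼-refl }
          ; *-homo = ι-* }
        ; 1#-homo = ∼-refl }
      ; -‿homo = λ a → ∼-trans (ι-cong (F.sym (RingProperties.-1*x≈-x F.ring a))) (ι-* _ _) }
    ; ι-central = ι-central }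

-- Modules over the free algebra.

module FreeAlgebraModule {ℓ} (F : Field ℓ) (B J : Set ℓ)
                         (ρ : J → B → FormalSums.L F B) where
  open FormalSums F B
  open FreeAlgebra F J
  private module F = Field F

  -- The linear map by which a term acts, given on basis elements. In a product the left factor acts
  -- first, since modules are right modules.
  ⟦_⟧ : Term → B → L
  ⟦ ι a ⟧   b = scalar a b
  ⟦ gen j ⟧ b = ρ j b
  ⟦ t ⊕ u ⟧ b = ⟦ t ⟧ b ++ ⟦ u ⟧ b
  ⟦ t ⊛ u ⟧ b = ext ⟦ u ⟧ (⟦ t ⟧ b)

  -- Every relation is a law valid for linear maps under sum and composition. None singles out a
  -- generator, so `ρ` can be arbitrary.
  sound : ∀ {t u} → t ∼ u → ∀ b → ⟦ t ⟧ b ≋ ⟦ u ⟧ b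
  sound ∼-refl              b = ≋-refl
  sound (∼-sym p)           b = ≋-sym (sound p b)
  sound (∼-trans p q)       b = ≋-trans (sound p b) (sound q b)
  sound (⊕-cong p q)      b = ++-cong (sound p b) (sound q b)
  sound (⊛-cong p q)      b = ext-cong (sound q) (sound p b)
  sound (⊕-assoc t u v)   b = ++-assoc (⟦ t ⟧ b) (⟦ u ⟧ b) (⟦ v ⟧ b)
  sound (⊕-comm t u)      b = ++-comm (⟦ t ⟧ b) (⟦ u ⟧ b)
  sound (⊕-idˡ t)         b = ≋-by λ φ →
    F.trans (F.+-congʳ (F.zeroˡ _)) (F.+-identityˡ _)
  sound (⊛-assoc t u v)   b = ext-∘ ⟦ v ⟧ ⟦ u ⟧ (⟦ t ⟧ b)
  sound (⊛-idˡ t)         b = ext-basis ⟦ t ⟧ b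
  sound (⊛-zeroˡ t)       b = ≋-trans (++-identityʳ _)
    (≋-trans (0·x≋0 (⟦ t ⟧ b) F.refl)
      (≋-by λ φ → F.sym (F.trans (F.+-identityʳ _) (F.zeroˡ _))))
  sound (distribˡ t u v)  b = ext-sum ⟦ u ⟧ ⟦ v ⟧ (⟦ t ⟧ b)
  sound (distribʳ t u v)  b = ext-++ ⟦ t ⟧ (⟦ u ⟧ b) (⟦ v ⟧ b)
  sound (ι-cong p)        b = ≋-by λ φ → F.+-congʳ (F.*-congʳ p)
  sound (ι-+ a c)         b = ≋-by λ φ →
    F.trans (F.+-congʳ (F.distribʳ _ a c)) (F.+-assoc _ _ _)
  sound (ι-* a c)         b = ≋-refl
  sound (ι-central a t)   b =
    ≋-trans (++-identityʳ _) (≋-sym (ext-scalar a (⟦ t ⟧ b)))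

  rightModule : RightModule ring ℓ ℓ
  rightModule = record
    { Carrierᴹ = L ; _≈ᴹ_ = _≋_ ; _+ᴹ_ = _++_ ; 0ᴹ = [] ; -ᴹ_ = neg
    ; _*ᵣ_ = λ x t → ext ⟦ t ⟧ x
    ; isRightModule = record
      { isRightSemimodule = record
        { +ᴹ-isCommutativeMonoid = record
          { isMonoid = record
            { isSemigroup = record
              { isMagma = record
                { isEquivalence = Setoid.isEquivalence ≋-setoid
                ; ∙-cong = ++-cong }
              ; assoc = ++-assoc }
            ; identity = (λ x → ≋-refl) , ++-identityʳ }
          ; comm = ++-comm }
        ; isPrerightSemimodule = record
          { *ᵣ-cong = λ p q → ext-cong (sound q) p
          ; *ᵣ-zeroʳ = λ x → ext-0 _ x λ b → ≋-by λ φ → F.trans (F.+-identityʳ _) (F.zeroˡ _)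
          ; *ᵣ-distribˡ = λ x t u → ext-sum ⟦ t ⟧ ⟦ u ⟧ x
          ; *ᵣ-identityʳ = basis-ext
          ; *ᵣ-assoc = λ x t u → ext-∘ ⟦ u ⟧ ⟦ t ⟧ x
          ; *ᵣ-zeroˡ = λ t → ≋-refl
          ; *ᵣ-distribʳ = λ t x y → ext-++ ⟦ t ⟧ x y } }
      ; -ᴹ‿cong = ·-cong F.refl
      ; -ᴹ‿inverse = (λ x → ≋-trans (++-comm (neg x) x) (neg-inverseʳ x)) , neg-inverseʳ } }

-- Sums of submodules and transfer of complements.

module SubmoduleLemmas {ℓ} {R : Ring ℓ ℓ} (M : RightModule R ℓ ℓ) where
  open RightModule M
  open Submodule
  private
    module R = Ring R
    open CommutativeSemigroupProperties
      (CommutativeMonoid.commutativeSemigroup +ᴹ-commutativeMonoid) using (interchange)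
  open SetoidReasoning ≈ᴹ-setoid

  -- Submodules are given as closed under the action, not under negation, so subtraction is done by
  -- acting with -1.
  *-neg-inverseʳ : ∀ v → v +ᴹ v *ᵣ (R.- R.1#) ≈ᴹ 0ᴹ
  *-neg-inverseʳ v = begin
    v +ᴹ v *ᵣ (R.- R.1#)          ≈⟨ +ᴹ-congʳ (*ᵣ-identityʳ v) ⟨
    v *ᵣ R.1# +ᴹ v *ᵣ (R.- R.1#)  ≈⟨ *ᵣ-distribˡ v _ _ ⟨
    v *ᵣ (R.1# R.+ R.- R.1#)      ≈⟨ *ᵣ-cong ≈ᴹ-refl (R.-‿inverseʳ R.1#) ⟩
    v *ᵣ R.0#                     ≈⟨ *ᵣ-zeroʳ v ⟩
    0ᴹ                            ∎

  infixl 6 _∔_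
  _∔_ : Submodule M → Submodule M → Submodule M
  X ∔ V = record
    { member = λ u → ∃[ x ] ∃[ v ] (x ∈ member X × v ∈ member V × u ≈ᴹ x +ᴹ v)
    ; ≈-closed = λ { u≈u′ (x , v , x∈X , v∈V , eq) →
        x , v , x∈X , v∈V , ≈ᴹ-trans (≈ᴹ-sym u≈u′) eq }
    ; 0-closed = 0ᴹ , 0ᴹ , 0-closed X , 0-closed V , ≈ᴹ-sym (+ᴹ-identityˡ 0ᴹ)
    ; +-closed = λ { (x , v , x∈X , v∈V , eq) (x′ , v′ , x′∈X , v′∈V , eq′) →
        x +ᴹ x′ , v +ᴹ v′ , +-closed X x∈X x′∈X , +-closed V v∈V v′∈V ,
        ≈ᴹ-trans (+ᴹ-cong eq eq′) (interchange x v x′ v′) }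
    ; *ᵣ-closed = λ { r (x , v , x∈X , v∈V , eq) →
        x *ᵣ r , v *ᵣ r , *ᵣ-closed X r x∈X , *ᵣ-closed V r v∈V ,
        ≈ᴹ-trans (*ᵣ-cong eq R.refl) (*ᵣ-distribʳ r x v) }
    }

  -- Modular law: the new complement is X + V′.
  complementedOver-mono : ∀ {W W′ V V′} →
    member W ≐ member W′ → member V ⊆ member V′ → member V′ ⊆ member W′ →
    ComplementedOver M W V → ComplementedOver M W′ V′
  complementedOver-mono {W} {W′} {V} {V′} (W⊆W′ , W′⊆W) V⊆V′ V′⊆W′ (X , (W∩X⊆V , _) , W+X) =
    X ∔ V′ , (to , from) , sum
    where
    to : (member W′ ∩ member (X ∔ V′)) ⊆ member V′
    to {u} (u∈W′ , x , v , x∈X , v∈V′ , u≈x+v) =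
      ≈-closed V′ (≈ᴹ-sym u≈x+v) (+-closed V′ (V⊆V′ (W∩X⊆V (x∈W , x∈X))) v∈V′)
      where
      -v : Carrierᴹ
      -v = v *ᵣ (R.- R.1#)
      u-v≈x : u +ᴹ -v ≈ᴹ x
      u-v≈x = begin
        u +ᴹ -v          ≈⟨ +ᴹ-congʳ u≈x+v ⟩
        x +ᴹ v +ᴹ -v     ≈⟨ +ᴹ-assoc x v -v ⟩
        x +ᴹ (v +ᴹ -v)   ≈⟨ +ᴹ-congˡ (*-neg-inverseʳ v) ⟩
        x +ᴹ 0ᴹ          ≈⟨ +ᴹ-identityʳ x ⟩
        x                ∎
      x∈W : x ∈ member W
      x∈W = W′⊆W (≈-closed W′ u-v≈x (+-closed W′ u∈W′ (V′⊆W′ (*ᵣ-closed V′ _ v∈V′))))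
    from : member V′ ⊆ (member W′ ∩ member (X ∔ V′))
    from {v} v∈V′ = V′⊆W′ v∈V′ , 0ᴹ , v , 0-closed X , v∈V′ , ≈ᴹ-sym (+ᴹ-identityˡ v)
    sum : ∀ u → ∃[ w ] ∃[ x ] (w ∈ member W′ × x ∈ member (X ∔ V′) × u ≈ᴹ w +ᴹ x)
    sum u with W+X u
    ... | w , x , w∈W , x∈X , eq =
      w , x , W⊆W′ w∈W , (x , 0ᴹ , x∈X , 0-closed V′ , ≈ᴹ-sym (+ᴹ-identityʳ x)) , eq

-- Well-orders with excluded middle.

module ClassicalOrder (em : ∀ {a} → ExcludedMiddle a) {ℓ} (κ : Ordinal ℓ) where
  open Ordinal κ
  open IsStrictTotalOrder isStrictTotalOrder public
    using (compare; _<?_; asym; irrefl) renaming (trans to <-trans)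

  infix 4 _≤_
  -- In this form `asym` turns a strict inequality into a weak one, and `<-irrefl` is reflexivity.
  _≤_ : Carrier → Carrier → Set ℓ
  x ≤ y = ¬ (y < x)

  <-irrefl : ∀ {x} → ¬ (x < x)
  <-irrefl = irrefl refl

  ≰⇒> : ∀ {x y} → ¬ (x ≤ y) → y < x
  ≰⇒> {x} {y} = decidable-stable (y <? x)

  ≤-<-trans : ∀ {x y z} → x ≤ y → y < z → x < z
  ≤-<-trans {x} {y} x≤y y<z with compare x y
  ... | tri< x<y _ _  = <-trans x<y y<z
  ... | tri≈ _ refl _ = y<z
  ... | tri> _ _ y<x  = contradiction y<x x≤y

  <-≤-trans : ∀ {x y z} → x < y → y ≤ z → x < z
  <-≤-trans {x} {y} {z} x<y y≤z with compare y z
  ... | tri< y<z _ _  = <-trans x<y y<z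
  ... | tri≈ _ refl _ = x<y
  ... | tri> _ _ z<y  = contradiction z<y y≤z

  least : ∀ {p} (P : Pred Carrier p) → ∃[ α ] α ∈ P → ∃[ α ] (α ∈ P × (∀ β → β ∈ P → α ≤ β))
  least {p} P (α , α∈P) = WF.All.wfRec <-wellFounded _ Q step α α∈P
    where
    Q : Carrier → Set (ℓ ⊔ p)
    Q α = α ∈ P → ∃[ β ] (β ∈ P × (∀ γ → γ ∈ P → β ≤ γ))
    step : ∀ α → (∀ {β} → β < α → Q β) → Q α
    step α ih α∈P with em {P = ∃[ β ] (β < α × β ∈ P)}
    ... | yes (β , β<α , β∈P) = ih β<α β∈P
    ... | no  none = α , α∈P , λ β β∈P β<α → none (β , β<α , β∈P)

  predecessor-or-limit : ∀ {β α} → β < α → IsLimit α ⊎ (∃[ δ ] IsSuccessor δ α)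
  predecessor-or-limit {β} {α} β<α with em {P = ∃[ δ ] IsSuccessor δ α}
  ... | yes s = inj₂ s
  ... | no ¬s = inj₁ ((β , β<α) , between)
    where
    between : ∀ β → β < α → ∃[ γ ] (β < γ × γ < α)
    between β β<α with em {P = ∃[ γ ] (β < γ × γ < α)}
    ... | yes b = b
    ... | no ¬b = contradiction (β , β<α , λ γ p → ¬b (γ , p)) ¬s

  <-successor : ∀ {δ δ⁺ β} → IsSuccessor δ δ⁺ → β < δ⁺ → β ≤ δ
  <-successor (_ , none) β<δ⁺ δ<β = none _ (δ<β , β<δ⁺)

  upperBound : (∀ α → ∃[ β ] α < β) → ∀ α β → ∃[ γ ] (α < γ × β < γ)
  upperBound next α β with α <? β
  ... | yes α<β = next β .proj₁ , <-trans α<β (next β .proj₂) , next β .proj₂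
  ... | no  α≮β = next α .proj₁ , next α .proj₂ , ≤-<-trans α≮β (next α .proj₂)

  successor : (∀ α → ∃[ β ] α < β) → ∀ α → ∃[ α⁺ ] IsSuccessor α α⁺
  successor next α with least (α <_) (next α)
  ... | α⁺ , α<α⁺ , min = α⁺ , α<α⁺ , λ γ p → min γ (proj₁ p) (proj₂ p)

-- Monotonicity of chains.

module ChainLemmas (em : ∀ {a} → ExcludedMiddle a) {ℓ} {R : Ring ℓ ℓ} {M : RightModule R ℓ ℓ}
                   {κ : Ordinal ℓ} (𝒰 : CDC M κ) where
  open Ordinal κ
  open ClassicalOrder em κ
  open CDC 𝒰
  open Submodule

  -- A chain is specified only at limits and from one index to its successor; induction on the
  -- larger index joins these steps.
  antitone-< : ∀ {β α} → β < α → member (U α) ⊆ member (U β)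
  antitone-< {β} {α} = WF.All.wfRec <-wellFounded _ Q step α
    where
    Q : Carrier → Set ℓ
    Q α = ∀ {β} → β < α → member (U α) ⊆ member (U β)
    step : ∀ α → (∀ {γ} → γ < α → Q γ) → Q α
    step α ih {β} β<α x∈ with predecessor-or-limit β<α
    ... | inj₁ lim     = proj₁ (continuous α lim) x∈ β β<α
    ... | inj₂ (δ , s) with decreasing δ α s .proj₁ x∈ | compare β δ
    ...   | x∈δ | tri< β<δ _ _  = ih (proj₁ s) β<δ x∈δ
    ...   | x∈δ | tri≈ _ refl _ = x∈δ
    ...   | x∈δ | tri> _ _ δ<β  = contradiction δ<β (<-successor s β<α)

  antitone : ∀ {β α} → β ≤ α → member (U α) ⊆ member (U β)
  antitone {β} {α} β≤α x∈ with compare β α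
  ... | tri< β<α _ _  = antitone-< β<α x∈
  ... | tri≈ _ refl _ = x∈
  ... | tri> _ _ α<β  = contradiction α<β β≤α

-- Successors, countable bounds and closure points in a regular uncountable cardinal.

module RegularCardinal (em : ∀ {a} → ExcludedMiddle a) {ℓ} (κ : Ordinal ℓ)
                       (reg : IsRegularUncountableCardinal κ) where
  open Ordinal κ
  open ClassicalOrder em κ
  open IsRegularUncountableCardinal reg

  inhabitant : Carrier
  inhabitant with em {P = Carrier}
  ... | yes x = x
  ... | no ¬x = contradiction
    (record { to = λ x → contradiction x ¬x ; cong = λ {x} _ → contradiction x ¬x
            ; injective = λ {x} _ → contradiction x ¬x })
    isUncountable

  private
    somePair : ∃[ α ] ∃[ β ] β < α
    somePair with em {P = ∃[ α ] ∃[ β ] β < α}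
    ... | yes p = p
    ... | no ¬p = contradiction
      (record { to = λ _ → 0 ; cong = λ _ → refl ; injective = λ {x} {y} _ → equal x y })
      isUncountable
      where
      equal : ∀ x y → x ≡ y
      equal x y with compare x y
      ... | tri< x<y _ _ = contradiction (y , x , x<y) ¬p
      ... | tri≈ _ eq _  = eq
      ... | tri> _ _ y<x = contradiction (x , y , y<x) ¬p

  segment-bounded : ∀ α (f : Func (segment α) underlying) → ∃[ β ] ∀ x → Func.to f x < β
  segment-bounded α f with em {P = ∃[ β ] ∀ x → Func.to f x < β}
  ... | yes b = b
  ... | no ¬b = contradiction cofinal (isRegular α f)
    where
    cofinal : Cofinal κ f
    cofinal β with em {P = ∃[ x ] β ≤ Func.to f x}
    ... | yes c = c
    ... | no ¬c = contradiction (β , λ x → decidable-stable (_ <? _) λ n → ¬c (x , n)) ¬b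

  -- Regularity bounds the constant map `α` on a non-empty segment strictly, and such a bound lies
  -- above `α`.
  next : ∀ α → ∃[ β ] α < β
  next α with somePair
  ... | γ , δ , δ<γ with segment-bounded γ (record { to = λ _ → α ; cong = λ _ → refl })
  ...   | β , bound = β , bound (δ , δ<γ)

  suc⁺ : Carrier → Carrier
  suc⁺ α = successor next α .proj₁

  suc⁺-isSuccessor : ∀ α → IsSuccessor α (suc⁺ α)
  suc⁺-isSuccessor α = successor next α .proj₂

  <-suc⁺ : ∀ {α} → α < suc⁺ α
  <-suc⁺ {α} = suc⁺-isSuccessor α .proj₁

  private
    bottom : ∃[ α ] (α ≡ α × (∀ β → β ≡ β → α ≤ β))
    bottom = least (λ α → α ≡ α) (inhabitant , refl)

    e : ℕ → Carrier
    e ℕ.zero    = bottom .proj₁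
    e (ℕ.suc n) = suc⁺ (e n)

    e-mono : ∀ {m n} → m <′ n → e m < e n
    e-mono (≤′-reflexive refl) = <-suc⁺
    e-mono (≤′-step p)   = <-trans (e-mono p) <-suc⁺

    e-injective : ∀ m n → e m ≡ e n → m ≡ n
    e-injective m n eq with ℕₚ.<-cmp m n
    ... | tri< m<n _ _ = contradiction (subst (e m <_) (sym eq) (e-mono (ℕₚ.<⇒<′ m<n))) <-irrefl
    ... | tri≈ _ m≡n _ = m≡n
    ... | tri> _ _ n<m = contradiction (subst (e n <_) eq (e-mono (ℕₚ.<⇒<′ n<m))) <-irrefl

    e-initial : ∀ n {w} → w < e n → ∃[ m ] w ≡ e m
    e-initial ℕ.zero    w<e = contradiction w<e (bottom .proj₂ .proj₂ _ refl)
    e-initial (ℕ.suc n) {w} w<e with compare w (e n)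
    ... | tri< w<en _ _ = e-initial n w<en
    ... | tri≈ _ eq _   = n , eq
    ... | tri> _ _ en<w = contradiction en<w (<-successor (suc⁺-isSuccessor (e n)) w<e)

    -- The `e n` are the finite ordinals of `κ` and form an initial segment. Were they unbounded,
    -- every element would be some `e m`, and `κ` would inject into `ℕ`.
    ω-exists : ∃[ w ] ∀ n → e n < w
    ω-exists with em {P = ∃[ w ] ∀ n → e n < w}
    ... | yes b = b
    ... | no ¬b = contradiction
      (record { to = λ w → index w .proj₁
              ; cong = λ { refl → refl }
              ; injective = λ {x} {y} eq →
                  trans (index x .proj₂) (trans (cong e eq) (sym (index y .proj₂))) })
      isUncountable
      where
      index : ∀ w → ∃[ m ] w ≡ e m
      index w with em {P = ∃[ n ] w < e n}
      ... | yes (n , w<en) = e-initial n w<en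
      ... | no ¬n = contradiction
        (suc⁺ w , λ n → ≤-<-trans (λ w<en → ¬n (n , w<en)) <-suc⁺) ¬b

    index : Carrier → ℕ
    index w with em {P = ∃[ m ] w ≡ e m}
    ... | yes (m , _) = m
    ... | no  _       = 0

    index-e : ∀ n → index (e n) ≡ n
    index-e n with em {P = ∃[ m ] e n ≡ e m}
    ... | yes (m , eq) = sym (e-injective n m eq)
    ... | no  none     = contradiction (n , refl) none

  -- Regularity speaks of families indexed by a segment, so the sequence is spread over the segment
  -- below a bound of the finite ordinals. Elements that are not of the form `e n` only repeat
  -- `s 0`.
  sequence-bounded : (s : ℕ → Carrier) → ∃[ β ] ∀ n → s n < β
  sequence-bounded s with ω-exists
  ... | w , below with segment-bounded w (record
          { to = λ x → s (index (proj₁ x)) ; cong = λ eq → cong (λ x → s (index x)) eq })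
  ...   | β , bound = β , λ n → subst (λ m → s m < β) (index-e n) (bound (e n , below n))

  private
    ascend : (Carrier → Carrier) → Carrier → ℕ → Carrier
    ascend h β ℕ.zero    = β
    ascend h β (ℕ.suc n) = upperBound next (ascend h β n) (h (ascend h β n)) .proj₁

  -- The point is the supremum of an increasing sequence in which each term also exceeds `h` of the
  -- term before. As `h` need not be monotone, closure is asserted only for cofinally many `δ`.
  closurePoint : (h : Carrier → Carrier) → ∀ β → ∃[ α ]
    (β < α × IsLimit α × (∀ γ → γ < α → ∃[ δ ] (γ ≤ δ × h δ < α)))
  closurePoint h β with least (λ α → ∀ n → ascend h β n < α) (sequence-bounded (ascend h β))
  ... | α , s<α , min = α , s<α 0 , ((β , s<α 0) , limit) , closed
    where
    s : ℕ → Carrier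
    s = ascend h β
    s-suc : ∀ n → s n < s (ℕ.suc n) × h (s n) < s (ℕ.suc n)
    s-suc n = upperBound next (s n) (h (s n)) .proj₂
    overtake : ∀ γ → γ < α → ∃[ n ] γ ≤ s n
    overtake γ γ<α with em {P = ∃[ n ] γ ≤ s n}
    ... | yes p = p
    ... | no ¬p = contradiction γ<α (min γ λ n → decidable-stable (_ <? _) λ q → ¬p (n , q))
    limit : ∀ γ → γ < α → ∃[ δ ] (γ < δ × δ < α)
    limit γ γ<α with overtake γ γ<α
    ... | n , γ≤sn = s (ℕ.suc n) , ≤-<-trans γ≤sn (s-suc n .proj₁) , s<α (ℕ.suc n)
    closed : ∀ γ → γ < α → ∃[ δ ] (γ ≤ δ × h δ < α)
    closed γ γ<α with overtake γ γ<α
    ... | n , γ≤sn = s n , γ≤sn , <-trans (s-suc n .proj₂) (s<α (ℕ.suc n))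

-- Minimality of the dimension and independence of Γ from the chain.

module ChainInvariants (em : ∀ {a} → ExcludedMiddle a) {ℓ} (κ : Ordinal ℓ)
                       (reg : IsRegularUncountableCardinal κ)
                       {R : Ring ℓ ℓ} {M : RightModule R ℓ ℓ} where
  open Ordinal κ
  open ClassicalOrder em κ
  open RegularCardinal em κ reg
  open Submodule
  open CDC using (U; NonComplemented)
  private
    module Chain (μ : Ordinal ℓ) = ChainLemmas em {R = R} {M = M} {κ = μ}

  -- If `α < β`, the inclusion would put `U α` inside the next member of the chain, against strict
  -- decrease.
  ⊆⇒≤ : (𝒰 : CDC M κ) → ∀ {α β} → member (U 𝒰 α) ⊆ member (U 𝒰 β) → β ≤ α
  ⊆⇒≤ 𝒰 {α} {β} Uα⊆Uβ α<β =
    CDC.decreasing 𝒰 α (suc⁺ α) (suc⁺-isSuccessor α) .proj₂ λ x∈Uα →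
      Chain.antitone κ 𝒰 (λ β<α⁺ → <-successor (suc⁺-isSuccessor α) β<α⁺ α<β) (Uα⊆Uβ x∈Uα)

  module _ (𝒰 : CDC M κ) (μ : Ordinal ℓ) (𝒱 : CDC M μ) where
    private
      module μ = Ordinal μ
      module μₚ = ClassicalOrder em μ

    -- Below α ξ says that the order type of α is at most that of ξ; sending α
    -- to the least such ξ is strictly increasing wherever it is defined, and
    -- regularity of κ makes it defined everywhere.
    data Below : Carrier → μ.Carrier → Set ℓ where
      below : ∀ {α ξ} → (∀ β → β < α → ∃[ η ] (η μ.< ξ × Below β η)) → Below α ξ

    private
      into-𝒱 : Carrier → μ.Carrier
      into-𝒱 α = CDC.cofinal 𝒱 (U 𝒰 α) (CDC.nonZero 𝒰 α) .proj₁

      into-𝒰 : μ.Carrier → Carrier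
      into-𝒰 ξ = CDC.cofinal 𝒰 (U 𝒱 ξ) (CDC.nonZero 𝒱 ξ) .proj₁

      rank : Carrier → μ.Carrier
      rank α with em {P = ∃[ ξ ] Below α ξ}
      ... | yes p = μₚ.least (Below α) p .proj₁
      -- A placeholder; `rank-exists` shows that this case does not occur.
      ... | no  _ = into-𝒱 α

      rank-spec : ∀ {α} → ∃[ ξ ] Below α ξ →
                  Below α (rank α) × (∀ ξ → Below α ξ → rank α μₚ.≤ ξ)
      rank-spec {α} p with em {P = ∃[ ξ ] Below α ξ}
      ... | yes q = μₚ.least (Below α) q .proj₂
      ... | no ¬q = contradiction p ¬q

      -- If no `ξ` bounds `α`, the ranks of elements below `α` reach `into-𝒱 β` for every `β`.
      -- Carried back by `into-𝒰`, they would be cofinal in `κ` and indexed by a proper segment.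
      rank-exists : ∀ α → ∃[ ξ ] Below α ξ
      rank-exists = WF.All.wfRec <-wellFounded _ (λ α → ∃[ ξ ] Below α ξ) step
        where
        step : ∀ α → (∀ {β} → β < α → ∃[ ξ ] Below β ξ) → ∃[ ξ ] Below α ξ
        step α ih with em {P = ∃[ ξ ] Below α ξ}
        ... | yes p = p
        ... | no ¬p = contradiction unbounded (IsRegularUncountableCardinal.isRegular reg α f)
          where
          f : Func (segment α) underlying
          f = record { to = λ x → into-𝒰 (rank (proj₁ x)) ; cong = cong (λ x → into-𝒰 (rank x)) }
          unbounded : Cofinal κ f
          unbounded β with em {P = ∃[ x ] (into-𝒱 β μₚ.≤ rank (proj₁ {B = λ γ → γ < α} x))}
          ... | yes (x , ξ≤rank) = x , ⊆⇒≤ 𝒰 λ u∈ →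
                  CDC.cofinal 𝒱 (U 𝒰 β) (CDC.nonZero 𝒰 β) .proj₂
                    (Chain.antitone μ 𝒱 ξ≤rank
                      (CDC.cofinal 𝒰 _ (CDC.nonZero 𝒱 (rank (proj₁ x))) .proj₂ u∈))
          ... | no none = contradiction
                  (into-𝒱 β , below λ γ γ<α →
                    rank γ , μₚ.≰⇒> (λ le → none ((γ , γ<α) , le)) , rank-spec (ih γ<α) .proj₁)
                  ¬p

    dimension-minimal : κ ≤ₒ μ
    dimension-minimal = rank , increasing
      where
      increasing : ∀ α β → α < β → rank α μ.< rank β
      increasing α β α<β with rank-spec (rank-exists β) .proj₁
      ... | below h with h α α<β
      ...   | η , η<rankβ , belowα = μₚ.≤-<-trans (rank-spec (rank-exists α) .proj₂ η belowα) η<rankβ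

  hasDimension : CDC M κ → HasDimension M κ
  hasDimension 𝒰 = 𝒰 , dimension-minimal 𝒰

  -- Limits are built in because `Γ≡-from-chain` compares with `E` only there; the set is still a
  -- club.
  Agree : CDC M κ → CDC M κ → Subset
  Agree 𝒰 𝒱 α = IsLimit α × member (U 𝒰 α) ≐ member (U 𝒱 α)

  private
    bound : CDC M κ → CDC M κ → Carrier → Carrier
    bound 𝒰 𝒱 β = CDC.cofinal 𝒰 (U 𝒱 β) (CDC.nonZero 𝒱 β) .proj₁

    bound-⊆ : (𝒰 𝒱 : CDC M κ) → ∀ β → member (U 𝒰 (bound 𝒰 𝒱 β)) ⊆ member (U 𝒱 β)
    bound-⊆ 𝒰 𝒱 β = CDC.cofinal 𝒰 (U 𝒱 β) (CDC.nonZero 𝒱 β) .proj₂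

    -- For `γ < α` the member of `𝒰` at `α` lies in that at `bound 𝒰 𝒱 δ`, hence in the members of
    -- `𝒱` at `δ` and at `γ`. Continuity of `𝒱` collects these inclusions.
    agree-at : (𝒰 𝒱 : CDC M κ) → ∀ {α} → IsLimit α → (∀ γ → γ < α → ∃[ δ ] (γ ≤ δ × bound 𝒰 𝒱 δ < α)) →
               member (U 𝒰 α) ⊆ member (U 𝒱 α)
    agree-at 𝒰 𝒱 {α} lim closed x∈ = CDC.continuous 𝒱 α lim .proj₂ λ γ γ<α →
      let (δ , γ≤δ , b<α) = closed γ γ<α in
      Chain.antitone κ 𝒱 γ≤δ (bound-⊆ 𝒰 𝒱 δ (Chain.antitone κ 𝒰 (asym b<α) x∈))

    agree-limit : (𝒰 𝒱 : CDC M κ) → ∀ {α} → IsLimit α →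
      (∀ β → β < α → ∃[ γ ] (member (U 𝒰 γ) ⊆ member (U 𝒱 γ) × β < γ × γ < α)) →
      member (U 𝒰 α) ⊆ member (U 𝒱 α)
    agree-limit 𝒰 𝒱 {α} lim h x∈ = CDC.continuous 𝒱 α lim .proj₂ λ β β<α →
      let (γ , U⊆V , β<γ , γ<α) = h β β<α in
      Chain.antitone κ 𝒱 (asym β<γ) (U⊆V (Chain.antitone κ 𝒰 (asym γ<α) x∈))

  agree-isClub : (𝒰 𝒱 : CDC M κ) → IsClub (Agree 𝒰 𝒱)
  agree-isClub 𝒰 𝒱 = closed , unbounded
    where
    closed : Closed (Agree 𝒰 𝒱)
    closed α lim h = lim ,
      agree-limit 𝒰 𝒱 lim (λ β β<α → let (γ , (_ , eq) , q) = h β β<α in γ , proj₁ eq , q) ,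
      agree-limit 𝒱 𝒰 lim (λ β β<α → let (γ , (_ , eq) , q) = h β β<α in γ , proj₂ eq , q)
    both : Carrier → Carrier
    both β = upperBound next (bound 𝒰 𝒱 β) (bound 𝒱 𝒰 β) .proj₁
    both-spec : ∀ β → bound 𝒰 𝒱 β < both β × bound 𝒱 𝒰 β < both β
    both-spec β = upperBound next (bound 𝒰 𝒱 β) (bound 𝒱 𝒰 β) .proj₂
    unbounded : Unbounded (Agree 𝒰 𝒱)
    unbounded β = α , (lim ,
      agree-at 𝒰 𝒱 lim (λ γ γ<α →
        let (δ , γ≤δ , b) = closed-under γ γ<α in δ , γ≤δ , <-trans (both-spec δ .proj₁) b) ,
      agree-at 𝒱 𝒰 lim (λ γ γ<α →
        let (δ , γ≤δ , b) = closed-under γ γ<α in δ , γ≤δ , <-trans (both-spec δ .proj₂) b)) ,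
      β<α
      where
      point : ∃[ α ] (β < α × IsLimit α × (∀ γ → γ < α → ∃[ δ ] (γ ≤ δ × both δ < α)))
      point = closurePoint both β
      open Σ point renaming (proj₁ to α ; proj₂ to α-spec)
      β<α : β < α
      β<α = α-spec .proj₁
      lim : IsLimit α
      lim = α-spec .proj₂ .proj₁
      closed-under : ∀ γ → γ < α → ∃[ δ ] (γ ≤ δ × both δ < α)
      closed-under = α-spec .proj₂ .proj₂

  -- Take `δ` so large that the member of `𝒱` at `δ` lies in that of `𝒰` at `β`. By the modular law,
  -- a complement over the smaller submodule would give one over the larger.
  nonComplemented-transfer : (𝒰 𝒱 : CDC M κ) → ∀ {α} → member (U 𝒰 α) ≐ member (U 𝒱 α) →
    α ∈ NonComplemented 𝒰 → α ∈ NonComplemented 𝒱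
  nonComplemented-transfer 𝒰 𝒱 {α} (U⊆V , V⊆U) (β , α<β , ¬c)
    with upperBound next α (bound 𝒱 𝒰 β)
  ... | δ , α<δ , b<δ = δ , α<δ , λ c → ¬c
    (SubmoduleLemmas.complementedOver-mono M {U 𝒱 α} {U 𝒰 α} {U 𝒱 δ} {U 𝒰 β} (V⊆U , U⊆V)
      (λ x∈ → bound-⊆ 𝒱 𝒰 β (Chain.antitone κ 𝒱 (asym b<δ) x∈))
      (Chain.antitone κ 𝒰 (asym α<β))
      c)

  Γ≡-from-chain : (𝒰 : CDC M κ) (E : Subset) →
    (∀ α → IsLimit α → α ∈ NonComplemented 𝒰 → α ∈ E) →
    (∀ α → IsLimit α → α ∈ E → α ∈ NonComplemented 𝒰) →
    Γ≡ M κ E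
  Γ≡-from-chain 𝒰 E nc⇒E E⇒nc 𝒱 = Agree 𝒰 𝒱 , agree-isClub 𝒰 𝒱 ,
    (λ { (nc , a@(lim , U⊆V , V⊆U)) → nc⇒E _ lim (nonComplemented-transfer 𝒱 𝒰 (V⊆U , U⊆V) nc) , a }) ,
    (λ { (e  , a@(lim , eq)) → nonComplemented-transfer 𝒰 𝒱 eq (E⇒nc _ lim e) , a })

-- The module for a given κ and E.

module Construction
  (em : ∀ {a} → ExcludedMiddle a) {ℓ} (F : Field ℓ) (κ : Ordinal ℓ)
  (reg : IsRegularUncountableCardinal κ) (A : Set ℓ)
  (d z : A → Ordinal.Carrier κ) (letter : (δ ζ : Ordinal.Carrier κ) → A)
  (d-letter : ∀ δ ζ → d (letter δ ζ) ≡ δ) (z-letter : ∀ δ ζ → z (letter δ ζ) ≡ ζ)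
  (E : Ordinal.Subset κ)
  where
  open Ordinal κ
  open ClassicalOrder em κ
  open RegularCardinal em κ reg
  private
    B : Set ℓ
    B = List A
    module F = Field F
  open FormalSums F B
  open FreeAlgebra F (B → L)
  open SetoidReasoning ≋-setoid

  -- In the word a ∷ s the letter a comes last.  Seen from a place ν, it makes
  -- the word invisible for ν < d a, look like s for d a ≤ ν ≤ z a, and look
  -- like itself for z a < ν.
  p : Carrier → B → L
  p ν []      = basis []
  p ν (a ∷ s) = if does (z a <? ν) then basis (a ∷ s)
                else if does (ν <? d a) then [] else p ν s

  P : Carrier → L → L
  P ν = ext (p ν)

  infixr 6 _◂_
  -- This cuts `x` to the places from `d a` to `z a`, at the price of an unrelated value after
  -- `z a`.
  _◂_ : A → L → L
  a ◂ x = ext (λ s → basis (a ∷ s)) x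

  p-late : ∀ {ν a s} → z a < ν → p ν (a ∷ s) ≡ basis (a ∷ s)
  p-late {ν} {a} z<ν rewrite dec-true (z a <? ν) z<ν = refl

  p-early : ∀ {ν a s} → ν ≤ z a → ν < d a → p ν (a ∷ s) ≡ []
  p-early {ν} {a} ν≤z ν<d rewrite dec-false (z a <? ν) ν≤z | dec-true (ν <? d a) ν<d = refl

  p-mid : ∀ {ν a s} → ν ≤ z a → d a ≤ ν → p ν (a ∷ s) ≡ p ν s
  p-mid {ν} {a} ν≤z d≤ν rewrite dec-false (z a <? ν) ν≤z | dec-false (ν <? d a) d≤ν = refl

  ≡⇒≋ : ∀ {x y} → x ≡ y → x ≋ y
  ≡⇒≋ refl = ≋-refl

  P-◂ : ∀ ν a x → P ν (a ◂ x) ≋ ext (λ s → p ν (a ∷ s)) x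
  P-◂ ν a x = ≋-trans (ext-∘ (p ν) _ x) (ext-congˡ x λ s → ext-basis (p ν) (a ∷ s))

  P-early : ∀ {ν a} x → ν ≤ z a → ν < d a → P ν (a ◂ x) ≋ []
  P-early {ν} {a} x ν≤z ν<d = ≋-trans (P-◂ ν a x) (ext-0 _ x λ s → ≡⇒≋ (p-early {s = s} ν≤z ν<d))

  P-mid : ∀ {ν a} x → ν ≤ z a → d a ≤ ν → P ν (a ◂ x) ≋ P ν x
  P-mid {ν} {a} x ν≤z d≤ν = ≋-trans (P-◂ ν a x) (ext-congˡ x λ s → ≡⇒≋ (p-mid {s = s} ν≤z d≤ν))

  P-cong : ∀ ν {x y} → x ≋ y → P ν x ≋ P ν y
  P-cong ν = ext-congʳ (p ν)

  Vanishes : Pred Carrier ℓ → L → Set ℓ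
  Vanishes N x = ∀ ν → ν ∈ N → P ν x ≋ []

  Between : Carrier → Carrier → Pred Carrier ℓ
  Between α γ ν = α ≤ ν × ν < γ

  Preserves : Pred Carrier ℓ → (B → L) → Set ℓ
  Preserves N h = ∀ x → Vanishes N x → Vanishes N (ext h x)

  -- Between α γ cuts out the complement of U α over U γ.
  Good : (B → L) → Set ℓ
  Good h = (∀ α → Preserves (_< α) h) × (∀ α → ¬ (α ∈ E) → ∀ γ → Preserves (Between α γ) h)

  -- The generators, all maps `B → L`, depend on neither `κ` nor `E`, so one algebra serves every
  -- choice. Only the decision which generators act as zero depends on them.
  ρ : (B → L) → B → L
  ρ h with em {P = Good h}
  ... | yes _ = h
  ... | no  _ = λ _ → []

  ρ-good : ∀ {h} → Good h → ρ h ≡ h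
  ρ-good {h} good with em {P = Good h}
  ... | yes _ = refl
  ... | no ¬g = contradiction good ¬g

  open FreeAlgebraModule F B (B → L) ρ

  M : RightModule ring ℓ ℓ
  M = rightModule

  Vanishes-≋ : ∀ {N x y} → x ≋ y → Vanishes N x → Vanishes N y
  Vanishes-≋ x≋y v ν ν∈N = ≋-trans (P-cong ν (≋-sym x≋y)) (v ν ν∈N)

  Vanishes-++ : ∀ {N} x y → Vanishes N x → Vanishes N y → Vanishes N (x ++ y)
  Vanishes-++ x y v w ν ν∈N =
    ≋-trans (ext-++ (p ν) x y) (++-cong (v ν ν∈N) (w ν ν∈N))

  Vanishes-· : ∀ {N} a x → Vanishes N x → Vanishes N (a · x)
  Vanishes-· a x v ν ν∈N = ≋-trans (ext-· (p ν) a x) (·-cong F.refl (v ν ν∈N))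

  -- By linearity and composition only generators matter, and a generator that is not good acts as
  -- zero.
  preserves-⟦⟧ : ∀ {N} → (∀ h → Good h → Preserves N h) → ∀ t → Preserves N ⟦ t ⟧
  preserves-⟦⟧ inv (ι a) x v = Vanishes-≋ (≋-sym (ext-scalar a x)) (Vanishes-· a x v)
  preserves-⟦⟧ inv (gen h) x v with em {P = Good h}
  ... | yes good = inv h good x v
  ... | no  _    = Vanishes-≋ (≋-sym (ext-0 _ x λ _ → ≋-refl)) λ _ _ → ≋-refl
  preserves-⟦⟧ inv (t ⊕ u) x v =
    Vanishes-≋ (≋-sym (ext-sum ⟦ t ⟧ ⟦ u ⟧ x))
      (Vanishes-++ (ext ⟦ t ⟧ x) (ext ⟦ u ⟧ x) (preserves-⟦⟧ inv t x v) (preserves-⟦⟧ inv u x v))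
  preserves-⟦⟧ inv (t ⊛ u) x v =
    Vanishes-≋ (ext-∘ ⟦ u ⟧ ⟦ t ⟧ x) (preserves-⟦⟧ inv u (ext ⟦ t ⟧ x) (preserves-⟦⟧ inv t x v))

  vanishing : (N : Pred Carrier ℓ) → (∀ h → Good h → Preserves N h) → Submodule M
  vanishing N inv = record
    { member    = Vanishes N
    ; ≈-closed  = Vanishes-≋
    ; 0-closed  = λ _ _ → ≋-refl
    ; +-closed  = λ {x} {y} → Vanishes-++ x y
    ; *ᵣ-closed = λ {x} t → preserves-⟦⟧ inv t x }

  U : Carrier → Submodule M
  U α = vanishing (_< α) λ h good → proj₁ good α

  X : ∀ α → ¬ (α ∈ E) → Carrier → Submodule M
  X α α∉E γ = vanishing (Between α γ) λ h good → proj₂ good α α∉E γ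

  basis≉0 : ∀ b → ¬ (basis b ≋ [])
  basis≉0 b eq = F.1≉0 (F.trans (F.sym (pair-basis b λ _ → F.1#)) (pairing eq λ _ → F.1#))

  -- Invisible before `α` and seen as `basis []` at `α`, it witnesses that the chain drops strictly
  -- after `α`.
  marker : Carrier → L
  marker α = basis (letter α α ∷ [])

  marker-U : ∀ α → Vanishes (_< α) (marker α)
  marker-U α ν ν<α = ≋-trans (ext-basis (p ν) _)
    (≡⇒≋ (p-early (subst (ν ≤_) (sym (z-letter α α)) (asym ν<α))
                  (subst (ν <_) (sym (d-letter α α)) ν<α)))

  P-marker : ∀ α → P α (marker α) ≋ basis []
  P-marker α = ≋-trans (ext-basis (p α) _)
    (≡⇒≋ (p-mid (subst (α ≤_) (sym (z-letter α α)) <-irrefl)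
                (subst (_≤ α) (sym (d-letter α α)) <-irrefl)))

  complemented : ∀ α → ¬ (α ∈ E) → ∀ β → α < β → ComplementedOver M (U α) (U β)
  complemented α α∉E β α<β = X α α∉E β ,
    ((λ { {x} (u , v) ν ν<β → below-β {x} u v ν ν<β }) ,
     λ {x} u → (λ ν ν<α → u ν (<-trans ν<α α<β)) , λ ν q → u ν (proj₂ q)) ,
    split
    where
    below-β : ∀ {x} → Vanishes (_< α) x → Vanishes (Between α β) x → Vanishes (_< β) x
    below-β u v ν ν<β with ν <? α
    ... | yes ν<α = u ν ν<α
    ... | no  α≤ν = v ν (α≤ν , ν<β)
    a : A
    a = letter α β
    split : ∀ u → ∃[ w ] ∃[ x ] (Vanishes (_< α) w × Vanishes (Between α β) x × u ≋ w ++ x)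
    split u = w , u ++ neg w , w∈U , x∈X , ≋-sym w+x≋u
      where
      w : L
      -- The cut is zero before `α` and agrees with `u` on `[α, β)`, so the difference vanishes on
      -- that interval.
      w = a ◂ u
      ν≤z : ∀ {ν} → ν < β → ν ≤ z a
      ν≤z {ν} ν<β = subst (ν ≤_) (sym (z-letter α β)) (asym ν<β)
      w∈U : Vanishes (_< α) w
      w∈U ν ν<α = P-early u (ν≤z (<-trans ν<α α<β)) (subst (ν <_) (sym (d-letter α β)) ν<α)
      x∈X : Vanishes (Between α β) (u ++ neg w)
      x∈X ν (α≤ν , ν<β) = begin
        P ν (u ++ neg w)      ≈⟨ ext-++ (p ν) u (neg w) ⟩
        P ν u ++ P ν (neg w)  ≈⟨ ++-cong (≋-refl {P ν u}) (ext-· (p ν) (- 1#) w) ⟩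
        P ν u ++ neg (P ν w)  ≈⟨ ++-cong (≋-refl {P ν u}) (·-cong F.refl
                                   (P-mid u (ν≤z ν<β) (subst (_≤ ν) (sym (d-letter α β)) α≤ν))) ⟩
        P ν u ++ neg (P ν u)  ≈⟨ neg-inverseʳ (P ν u) ⟩
        []                    ∎
      w+x≋u : w ++ (u ++ neg w) ≋ u
      w+x≋u = begin
        w ++ (u ++ neg w)  ≈⟨ ++-comm w (u ++ neg w) ⟩
        (u ++ neg w) ++ w  ≈⟨ ++-assoc u (neg w) w ⟩
        u ++ (neg w ++ w)  ≈⟨ ++-cong (≋-refl {u}) (++-comm (neg w) w) ⟩
        u ++ (w ++ neg w)  ≈⟨ ++-cong (≋-refl {u}) (neg-inverseʳ w) ⟩
        u ++ []            ≈⟨ ++-identityʳ u ⟩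
        u                  ∎

  -- A fresh word is seen as itself from every place at or after `β`; the last letter alone decides
  -- this.
  Fresh : Carrier → B → Set ℓ
  Fresh β []      = ⊤
  Fresh β (a ∷ _) = z a < β

  AllFresh : Carrier → L → Set ℓ
  AllFresh β = All (λ t → Fresh β (proj₂ t))

  -- Below the threshold β the operator has rank one; on later letters it is
  -- forced by compatibility with the places.  With h the identity, p ν (T x)
  -- depends only on p ν x, for every ν.
  module Operator (c : B → K) (β : Carrier) (y : L) (y∈U : Vanishes (_< β) y)
                  (h : A → A) (z-h : ∀ a → z (h a) ≡ z a) where

    op : B → L
    op []      = c [] · y
    op (a ∷ s) = if does (z a <? β) then c (a ∷ s) · y else h a ◂ op s

    op-new : ∀ {a s} → z a < β → op (a ∷ s) ≡ c (a ∷ s) · y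
    op-new {a} z<β rewrite dec-true (z a <? β) z<β = refl

    op-old : ∀ {a s} → β ≤ z a → op (a ∷ s) ≡ h a ◂ op s
    op-old {a} β≤z rewrite dec-false (z a <? β) β≤z = refl

    T : L → L
    T = ext op

    op-early : ∀ ν → ν < β → ∀ b → P ν (op b) ≋ []
    op-early ν ν<β []      = Vanishes-· (c []) y y∈U ν ν<β
    op-early ν ν<β (a ∷ s) with z a <? β
    ... | yes z<β = Vanishes-· (c (a ∷ s)) y y∈U ν ν<β
    ... | no  β≤z with ν <? d (h a)
    ...   | yes ν<d = P-early (op s) ν≤z ν<d
      where ν≤z = subst (ν ≤_) (sym (z-h a)) (asym (<-≤-trans ν<β β≤z))
    ...   | no  d≤ν = ≋-trans (P-mid (op s) ν≤z d≤ν) (op-early ν ν<β s)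
      where ν≤z = subst (ν ≤_) (sym (z-h a)) (asym (<-≤-trans ν<β β≤z))

    T-early : ∀ x → Vanishes (_< β) (T x)
    T-early x ν ν<β = ≋-trans (ext-∘ (p ν) op x) (ext-0 _ x (op-early ν ν<β))

    -- Both sides are linear in `x`, so its words suffice. The argument is read at `ν₀` and the
    -- result at `ν`: the two coincide in `T-kernel` and differ for left limits.
    factor : ∀ {ν ν₀ x} → All (λ t → P ν (op (proj₂ t)) ≋ P ν (T (p ν₀ (proj₂ t)))) x →
             P ν (T x) ≋ P ν (T (P ν₀ x))
    factor {ν} {ν₀} {x} eqs = begin
      P ν (T x)                        ≈⟨ ext-∘ (p ν) op x ⟩
      ext (λ b → P ν (op b)) x         ≈⟨ ext-cong-All eqs ⟩
      ext (λ b → P ν (T (p ν₀ b))) x   ≈⟨ ext-∘ (p ν) (λ b → T (p ν₀ b)) x ⟨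
      P ν (ext (λ b → T (p ν₀ b)) x)   ≈⟨ P-cong ν (ext-∘ op (p ν₀) x) ⟨
      P ν (T (P ν₀ x))                 ∎

    vanish-factor : ∀ {ν ν₀ x} → P ν (T x) ≋ P ν (T (P ν₀ x)) → P ν₀ x ≋ [] → P ν (T x) ≋ []
    vanish-factor {ν} eq eq₀ = ≋-trans eq (P-cong ν (ext-congʳ op eq₀))

    module _ (ν : Carrier) (d-h : ∀ a → ν < d a → ν < d (h a)) (h-d : ∀ a → ν < d (h a) → ν < d a) where

      -- Before `β` both sides vanish. From `β` on, a word with `z a < ν` is seen as itself;
      -- otherwise the letter is old, and by assumption `a` and `h a` hide the rest of the word at
      -- `ν` or show it together.
      op-local : ∀ b → P ν (op b) ≋ P ν (T (p ν b))
      op-local b with ν <? β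
      ... | yes ν<β = ≋-trans (op-early ν ν<β b) (≋-sym (T-early (p ν b) ν ν<β))
      ... | no  β≤ν = go b
        where
        go : ∀ b → P ν (op b) ≋ P ν (T (p ν b))
        go []      = P-cong ν (≋-sym (ext-basis op []))
        go (a ∷ s) = go-∷ (z a <? ν) (ν <? d a)
          where
          go-∷ : Dec (z a < ν) → Dec (ν < d a) → P ν (op (a ∷ s)) ≋ P ν (T (p ν (a ∷ s)))
          go-∷ (yes z<ν) _ rewrite p-late {s = s} z<ν = P-cong ν (≋-sym (ext-basis op (a ∷ s)))
          go-∷ (no ν≤z) (yes ν<d)
            rewrite p-early {s = s} ν≤z ν<d | op-old {s = s} (λ z<β → ν≤z (<-≤-trans z<β β≤ν)) =
            P-early (op s) (subst (ν ≤_) (sym (z-h a)) ν≤z) (d-h a ν<d)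
          go-∷ (no ν≤z) (no d≤ν)
            rewrite p-mid {s = s} ν≤z d≤ν | op-old {s = s} (λ z<β → ν≤z (<-≤-trans z<β β≤ν)) =
            ≋-trans (P-mid (op s) (subst (ν ≤_) (sym (z-h a)) ν≤z) (λ q → d≤ν (h-d a q))) (go s)

      T-kernel : ∀ {x} → P ν x ≋ [] → P ν (T x) ≋ []
      T-kernel {x} = vanish-factor {x = x} (factor (ListAll.universal (λ t → op-local (proj₂ t)) x))

  module Rank1 (c : B → K) (β : Carrier) (y : L) (y∈U : Vanishes (_< β) y) where
    open Operator c β y y∈U (λ a → a) (λ a → refl) public

    op-good : Good op
    op-good = (λ α x v ν ν<α → kernel {x = x} ν (v ν ν<α)) , λ α _ γ x v ν q → kernel {x = x} ν (v ν q)
      where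
      kernel : ∀ {x} ν → P ν x ≋ [] → P ν (T x) ≋ []
      kernel {x} ν = T-kernel ν (λ _ q → q) (λ _ q → q) {x}

    op-fresh : ∀ b → Fresh β b → op b ≋ c b · y
    op-fresh []      _   = ≋-refl
    op-fresh (a ∷ s) z<β = ≡⇒≋ (op-new z<β)

    T-fresh : ∀ {x} → AllFresh β x → T x ≋ ⟪ x ∣ c ⟫ · y
    T-fresh {x} fr = ≋-trans (ext-cong-All (ListAll.map (λ {t} → op-fresh (proj₂ t)) fr)) (ext-rank1 c y x)

    action : ∀ {x} → AllFresh β x → ext ⟦ gen op ⟧ x ≋ ⟪ x ∣ c ⟫ · y
    action {x} fr = ≋-trans (≡⇒≋ (cong (λ h → ext h x) (ρ-good op-good))) (T-fresh fr)

  fresh-mono : ∀ {β γ} → β < γ → ∀ b → Fresh β b → Fresh γ b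
  fresh-mono β<γ []      _   = tt
  fresh-mono β<γ (a ∷ s) z<β = <-trans z<β β<γ

  allFresh-mono : ∀ {β γ x} → β < γ → AllFresh β x → AllFresh γ x
  allFresh-mono β<γ = ListAll.map (λ {t} → fresh-mono β<γ (proj₂ t))

  fresh-above : ∀ β₀ x → ∃[ β ] (β₀ < β × AllFresh β x)
  fresh-above β₀ []            = next β₀ .proj₁ , next β₀ .proj₂ , []
  fresh-above β₀ ((k , []) ∷ x) with fresh-above β₀ x
  ... | β , β₀<β , fr = β , β₀<β , tt ∷ fr
  fresh-above β₀ ((k , a ∷ s) ∷ x) with fresh-above β₀ x
  ... | β , β₀<β , fr with upperBound next β (z a)
  ...   | γ , β<γ , z<γ = γ , <-trans β₀<β β<γ , z<γ ∷ allFresh-mono β<γ fr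

  nonzero-functional : ∀ {x} → ¬ (x ≋ []) → ∃[ c ] ¬ (⟪ x ∣ c ⟫ ≈ 0#)
  nonzero-functional {x} x≉0 with em {P = ∃[ c ] ¬ (⟪ x ∣ c ⟫ ≈ 0#)}
  ... | yes p = p
  ... | no ¬p = contradiction (≋-by λ c → decidable-stable em λ n → ¬p (c , n)) x≉0

  contains-chain : ∀ (V : Submodule M) → NonZero M V → ∃[ α ] Submodule.member (U α) ⊆ Submodule.member V
  contains-chain V (x , x∈V , x≉0)
    with nonzero-functional x≉0 | fresh-above inhabitant x
  ... | c , cx≉0 | β , _ , fr with F.inverse _ cx≉0
  ...   | k , cx*k≈1 = β , λ {y} y∈U →
    let open Rank1 c β y y∈U
        -- The factor `k` normalises the coefficient `⟪ x ∣ c ⟫` to 1.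
        t = gen op ⊛ ι k
        xt≋y = begin
          ext ⟦ t ⟧ x                       ≈⟨ ext-∘ (scalar k) ⟦ gen op ⟧ x ⟨
          ext (scalar k) (ext ⟦ gen op ⟧ x) ≈⟨ ext-scalar k _ ⟩
          k · ext ⟦ gen op ⟧ x              ≈⟨ ·-cong F.refl (action fr) ⟩
          k · (⟪ x ∣ c ⟫ · y)               ≈⟨ ·-assoc k ⟪ x ∣ c ⟫ y ⟩
          (k * ⟪ x ∣ c ⟫) · y               ≈⟨ 1·x≋x y (F.trans (F.*-comm k _) cx*k≈1) ⟩
          y                                 ∎
    in Submodule.≈-closed V xt≋y (Submodule.*ᵣ-closed V t x∈V)

  chain : CDC M κ
  chain = record
    { U = U
    ; nonZero = λ α → marker α , marker-U α , basis≉0 _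
    ; start = λ α least x ν ν<α → contradiction ν<α (least ν)
    ; continuous = λ α lim →
        (λ x∈ β β<α ν ν<β → x∈ ν (<-trans ν<β β<α)) ,
        (λ x∈ ν ν<α → let (β , ν<β , β<α) = lim .proj₂ ν ν<α in x∈ β β<α ν ν<β)
    ; decreasing = λ α α⁺ s →
        (λ x∈ ν ν<α → x∈ ν (<-trans ν<α (proj₁ s))) ,
        (λ ⊆ → basis≉0 [] (≋-trans (≋-sym (P-marker α)) (⊆ {marker α} (marker-U α) α (proj₁ s))))
    ; cofinal = contains-chain }

  -- Non-complementation at limits in E.

  module NonSplit (α : Carrier) (limit : IsLimit α) (α∈E : α ∈ E) where

    -- Letters starting at α are moved to start at suc⁺ α, so that the value of
    -- T x at α depends only on the values of x at places just below α.
    shift : A → A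
    shift a with em {P = d a ≡ α}
    ... | yes _ = letter (suc⁺ α) (z a)
    ... | no  _ = a

    z-shift : ∀ a → z (shift a) ≡ z a
    z-shift a with em {P = d a ≡ α}
    ... | yes _ = z-letter _ _
    ... | no  _ = refl

    <-shift : ∀ {ν a} → ν < d a → ν < d (shift a)
    <-shift {ν} {a} ν<d with em {P = d a ≡ α}
    ... | yes refl = subst (ν <_) (sym (d-letter _ _)) (<-trans ν<d <-suc⁺)
    ... | no  _    = ν<d

    shift-< : ∀ {ν a} → ¬ (ν ≡ α) → ν < d (shift a) → ν < d a
    shift-< {ν} {a} ν≢α ν<d with em {P = d a ≡ α}
    ... | no  _    = ν<d
    ... | yes refl with compare ν α
    ...   | tri< ν<α _ _ = ν<α
    ...   | tri≈ _ ν≡α _ = contradiction ν≡α ν≢α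
    ...   | tri> _ _ α<ν = contradiction α<ν
            (<-successor (suc⁺-isSuccessor α) (subst (ν <_) (d-letter _ _) ν<d))

    shift-skips : ∀ {a} → α ≤ d a → α < d (shift a)
    shift-skips {a} α≤d with em {P = d a ≡ α}
    ... | yes _ = subst (α <_) (sym (d-letter _ _)) <-suc⁺
    ... | no d≢α with compare (d a) α
    ...   | tri< d<α _ _ = contradiction d<α α≤d
    ...   | tri≈ _ d≡α _ = contradiction d≡α d≢α
    ...   | tri> _ _ α<d = α<d

    shift-fixes : ∀ {a} → d a < α → shift a ≡ a
    shift-fixes {a} d<α with em {P = d a ≡ α}
    ... | yes refl = contradiction d<α <-irrefl
    ... | no  _    = refl

    open Operator (λ _ → 1#) α (marker α) (marker-U α) shift z-shift

    -- Neither threshold of the letter lies in `[ν₀, α)`. A word of such letters looks the same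
    -- throughout that interval, so its value at `ν₀` is its left limit at `α`.
    Separates : Carrier → A → Set ℓ
    Separates ν₀ a = (z a < α → z a < ν₀) × (d a < α → d a < ν₀)

    SeparatesAll : Carrier → L → Set ℓ
    SeparatesAll ν₀ = All (λ t → All (Separates ν₀) (proj₂ t))

    separates-mono : ∀ {ν ν′ a} → ν < ν′ → Separates ν a → Separates ν′ a
    separates-mono ν<ν′ (f , g) = (λ q → <-trans (f q) ν<ν′) , (λ q → <-trans (g q) ν<ν′)

    above : ∀ {β} → β < α → ∀ e → ∃[ ν ] (β < ν × ν < α × (e < α → e < ν))
    above {β} β<α e with e <? β
    ... | yes e<β = let (ν , β<ν , ν<α) = limit .proj₂ β β<α in
          ν , β<ν , ν<α , λ _ → <-trans e<β β<ν
    ... | no  β≤e with e <? α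
    ...   | yes e<α = let (ν , e<ν , ν<α) = limit .proj₂ e e<α in
            ν , ≤-<-trans β≤e e<ν , ν<α , λ _ → e<ν
    ...   | no  e≮α = let (ν , β<ν , ν<α) = limit .proj₂ β β<α in
            ν , β<ν , ν<α , λ e<α → contradiction e<α e≮α

    separate-word : ∀ {β} → β < α → ∀ s → ∃[ ν ] (β < ν × ν < α × All (Separates ν) s)
    separate-word β<α [] =
      let (ν , β<ν , ν<α) = limit .proj₂ _ β<α in ν , β<ν , ν<α , []
    separate-word β<α (a ∷ s) =
      let (ν₁ , β<ν₁ , ν₁<α , all) = separate-word β<α s
          (ν₂ , ν₁<ν₂ , ν₂<α , zs) = above ν₁<α (z a)
          (ν₃ , ν₂<ν₃ , ν₃<α , ds) = above ν₂<α (d a)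
      in ν₃ , <-trans β<ν₁ (<-trans ν₁<ν₂ ν₂<ν₃) , ν₃<α ,
         ((λ q → <-trans (zs q) ν₂<ν₃) , ds) ∷
         ListAll.map (λ {a} → separates-mono {a = a} (<-trans ν₁<ν₂ ν₂<ν₃)) all

    -- Only finitely many letters occur in `x`, and a limit leaves room above all their thresholds
    -- below it.
    separate : ∀ {β} → β < α → ∀ x → ∃[ ν ] (β < ν × ν < α × SeparatesAll ν x)
    separate β<α [] =
      let (ν , β<ν , ν<α) = limit .proj₂ _ β<α in ν , β<ν , ν<α , []
    separate β<α ((k , s) ∷ x) =
      let (ν₁ , β<ν₁ , ν₁<α , all)  = separate β<α x
          (ν₂ , ν₁<ν₂ , ν₂<α , alls) = separate-word ν₁<α s
      in ν₂ , <-trans β<ν₁ ν₁<ν₂ , ν₂<α ,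
         alls ∷ ListAll.map (ListAll.map (λ {a} → separates-mono {a = a} ν₁<ν₂)) all

    -- A letter with `z a < α` has already passed its end at `ν₀`. If `z a` is at least `α`, a
    -- letter starting before `α` is transparent at both places; one starting at `α` or later hides
    -- the word at `ν₀`, and after `shift` also at `α`.
    op-left-limit : ∀ {ν₀} → ν₀ < α → ∀ {b} → All (Separates ν₀) b → P α (op b) ≋ P α (T (p ν₀ b))
    op-left-limit ν₀<α [] = P-cong α (≋-sym (ext-basis op []))
    op-left-limit {ν₀} ν₀<α {a ∷ s} ((z-sep , d-sep) ∷ seps) = go (z a <? α) (d a <? α)
      where
      go : Dec (z a < α) → Dec (d a < α) → P α (op (a ∷ s)) ≋ P α (T (p ν₀ (a ∷ s)))
      go (yes z<α) _ rewrite p-late {s = s} (z-sep z<α) = P-cong α (≋-sym (ext-basis op (a ∷ s)))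
      go (no α≤z) (yes d<α)
        rewrite p-mid {s = s} (asym (<-≤-trans ν₀<α α≤z)) (asym (d-sep d<α))
              | op-old {s = s} α≤z | shift-fixes d<α =
        ≋-trans (P-mid (op s) α≤z (asym d<α)) (op-left-limit ν₀<α seps)
      go (no α≤z) (no α≤d)
        rewrite p-early {s = s} (asym (<-≤-trans ν₀<α α≤z)) (<-≤-trans ν₀<α α≤d)
              | op-old {s = s} α≤z =
        P-early (op s) (subst (α ≤_) (sym (z-shift a)) α≤z) (shift-skips α≤d)

    T-left-limit : ∀ {ν₀ x} → ν₀ < α → SeparatesAll ν₀ x → P ν₀ x ≋ [] → P α (T x) ≋ []
    T-left-limit {x = x} ν₀<α seps = vanish-factor {x = x}
      (factor (ListAll.map (op-left-limit ν₀<α) seps))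

    -- Away from `α` the operator acts place by place. At `α` it reads places just to the left, so
    -- `N` has to contain them.
    preserves : ∀ {N} → (α ∈ N → ∃[ δ ] (δ < α × (∀ ν → δ < ν → ν < α → ν ∈ N))) → Preserves N op
    preserves left x v ν ν∈N with em {P = ν ≡ α}
    ... | no  ν≢α  = T-kernel ν (λ a → <-shift {a = a}) (λ a → shift-< {a = a} ν≢α) {x} (v ν ν∈N)
    ... | yes refl with left ν∈N
    ...   | δ , δ<α , near with separate δ<α x
    ...     | ν₀ , δ<ν₀ , ν₀<α , seps = T-left-limit ν₀<α seps (v ν₀ (near ν₀ δ<ν₀ ν₀<α))

    -- Here membership of `α` in `E` enters: an interval `[δ, γ)` containing `α` with `δ` outside
    -- `E` cannot start at `α`, so it contains the places between `δ` and `α`.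
    op-good : Good op
    op-good = (λ γ → preserves λ α<γ →
                let (δ , δ<α) = limit .proj₁ in δ , δ<α , λ ν _ ν<α → <-trans ν<α α<γ) ,
              (λ δ δ∉E γ → preserves λ (δ≤α , α<γ) →
                δ , strict δ δ∉E δ≤α , λ ν δ<ν ν<α → asym δ<ν , <-trans ν<α α<γ)
      where
      strict : ∀ δ → ¬ (δ ∈ E) → δ ≤ α → δ < α
      strict δ δ∉E δ≤α with compare δ α
      ... | tri< δ<α _ _  = δ<α
      ... | tri≈ _ refl _ = contradiction α∈E δ∉E
      ... | tri> _ _ α<δ  = contradiction α<δ δ≤α

    not-complemented : ¬ ComplementedOver M (U α) (U (suc⁺ α))
    -- The empty word is decomposed because `T` sends it to `marker α`, whose value at `α` is
    -- non-zero.
    not-complemented (X , (U∩X⊆U⁺ , _) , U+X) with U+X (basis [])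
    ... | w , x , w∈U , x∈X , eq with separate (limit .proj₁ .proj₂) w
    ...   | ν₀ , _ , ν₀<α , seps = basis≉0 [] (begin
      basis []                    ≈⟨ P-marker α ⟨
      P α (marker α)              ≈⟨ P-cong α (1·x≋x (marker α) F.refl) ⟨
      P α (op [])                 ≈⟨ P-cong α (ext-basis op []) ⟨
      P α (T (basis []))          ≈⟨ P-cong α (ext-congʳ op eq) ⟩
      P α (T (w ++ x))            ≈⟨ P-cong α (ext-++ op w x) ⟩
      P α (T w ++ T x)            ≈⟨ ext-++ (p α) (T w) (T x) ⟩
      P α (T w) ++ P α (T x)      ≈⟨ ++-cong (T-left-limit ν₀<α seps (w∈U ν₀ ν₀<α))
                                             (U∩X⊆U⁺ (T-early x , Tx∈X) α <-suc⁺) ⟩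
      []                          ∎)
      where
      Tx∈X : T x ∈ Submodule.member X
      Tx∈X = subst (λ h → ext h x ∈ Submodule.member X) (ρ-good op-good)
               (Submodule.*ᵣ-closed X (gen op) x∈X)

  -- Endomorphisms are scalars.

  open RightModuleMorphisms (RightModule.rawRightModule M) (RightModule.rawRightModule M)
    using (IsRightModuleHomomorphism)

  scalar-isHomomorphism : ∀ {f : L → L} a → (∀ x → f x ≋ ext (scalar a) x) → IsRightModuleHomomorphism f
  scalar-isHomomorphism {f} a f≋a = record
    { +ᴹ-isGroupHomomorphism = record
      { isMonoidHomomorphism = record
        { isMagmaHomomorphism = record
          { isRelHomomorphism = record { cong = λ {x} {y} x≋y →
              ≋-trans (f≋a x) (≋-trans (ext-congʳ (scalar a) x≋y) (≋-sym (f≋a y))) }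
          ; homo = λ x y → ≋-trans (f≋a (x ++ y)) (≋-trans (ext-++ (scalar a) x y)
              (++-cong (≋-sym (f≋a x)) (≋-sym (f≋a y)))) }
        ; ε-homo = f≋a [] }
      ; ⁻¹-homo = λ x → ≋-trans (f≋a (neg x)) (≋-trans (ext-· (scalar a) (- 1#) x)
          (·-cong F.refl (≋-sym (f≋a x)))) }
    ; *ᵣ-homo = λ t x → begin
        f (ext ⟦ t ⟧ x)                   ≈⟨ f≋a _ ⟩
        ext (scalar a) (ext ⟦ t ⟧ x)      ≈⟨ ext-scalar a _ ⟩
        a · ext ⟦ t ⟧ x                   ≈⟨ ext-· ⟦ t ⟧ a x ⟨
        ext ⟦ t ⟧ (a · x)                 ≈⟨ ext-congʳ ⟦ t ⟧ (ext-scalar a x) ⟨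
        ext ⟦ t ⟧ (ext (scalar a) x)      ≈⟨ ext-congʳ ⟦ t ⟧ (f≋a x) ⟨
        ext ⟦ t ⟧ (f x)                   ∎ }

  module Endomorphism (f : L → L) (hom : IsRightModuleHomomorphism f) where
    open IsRightModuleHomomorphism hom using (⟦⟧-cong; *ᵣ-homo)

    f-· : ∀ a x → f (a · x) ≋ a · f x
    f-· a x = begin
      f (a · x)             ≈⟨ ⟦⟧-cong (ext-scalar a x) ⟨
      f (ext (scalar a) x)  ≈⟨ *ᵣ-homo (ι a) x ⟩
      ext (scalar a) (f x)  ≈⟨ ext-scalar a (f x) ⟩
      a · f x               ∎

    -- Taking x = basis [] shows that f is a scalar on a member of the chain;
    -- taking y there recovers every coordinate of f x.
    f-balanced : ∀ c β y x → Vanishes (_< β) y → AllFresh β x → AllFresh β (f x) →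
                 ⟪ x ∣ c ⟫ · f y ≋ ⟪ f x ∣ c ⟫ · y
    f-balanced c β y x y∈U fr fr′ = begin
      ⟪ x ∣ c ⟫ · f y           ≈⟨ f-· ⟪ x ∣ c ⟫ y ⟨
      f (⟪ x ∣ c ⟫ · y)         ≈⟨ ⟦⟧-cong (action fr) ⟨
      f (ext ⟦ gen op ⟧ x)      ≈⟨ *ᵣ-homo (gen op) x ⟩
      ext ⟦ gen op ⟧ (f x)      ≈⟨ action fr′ ⟩
      ⟪ f x ∣ c ⟫ · y           ∎
      where open Rank1 c β y y∈U

    one : B → K
    one _ = 1#

    value : K
    value = ⟪ f (basis []) ∣ one ⟫

    β₀ : Carrier
    β₀ = fresh-above inhabitant (f (basis [])) .proj₁

    f-on-chain : ∀ y → Vanishes (_< β₀) y → f y ≋ value · y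
    f-on-chain y y∈U = ≋-trans
      (≋-sym (1·x≋x (f y) (pair-basis [] one)))
      (f-balanced one β₀ y (basis []) y∈U (tt ∷ []) (fresh-above inhabitant (f (basis [])) .proj₂ .proj₂))

    -- Choose `β` beyond `β₀` and fresh for `x` and `f x`. On `marker β` the map `f` is
    -- multiplication by `value`, so balancing compares coefficients of the marker, and `one` reads
    -- them off.
    f-scalar : ∀ x → f x ≋ value · x
    f-scalar x = ≋-by λ c →
      let (β₁ , β₀<β₁ , fr)  = fresh-above β₀ x
          (β  , β₁<β  , fr′) = fresh-above β₁ (f x)
          y∈U = marker-U β
          y = marker β
          one-y = pair-basis (letter β β ∷ []) one
          module FR = SetoidReasoning F.setoid
          eq = ≋-trans (·-cong F.refl (≋-sym (f-on-chain y λ ν ν<β₀ → y∈U ν (<-trans ν<β₀ (<-trans β₀<β₁ β₁<β)))))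
                       (f-balanced c β y x y∈U (allFresh-mono β₁<β fr) fr′)
      in FR.begin
        ⟪ f x ∣ c ⟫                              FR.≈⟨ F.*-identityʳ _ ⟨
        ⟪ f x ∣ c ⟫ * 1#                         FR.≈⟨ F.*-congˡ one-y ⟨
        ⟪ f x ∣ c ⟫ * ⟪ y ∣ one ⟫                FR.≈⟨ pair-· _ y one ⟨
        ⟪ ⟪ f x ∣ c ⟫ · y ∣ one ⟫                FR.≈⟨ pairing eq one ⟨
        ⟪ ⟪ x ∣ c ⟫ · (value · y) ∣ one ⟫        FR.≈⟨ pair-· _ (value · y) one ⟩
        ⟪ x ∣ c ⟫ * ⟪ value · y ∣ one ⟫          FR.≈⟨ F.*-congˡ (pair-· value y one) ⟩
        ⟪ x ∣ c ⟫ * (value * ⟪ y ∣ one ⟫)        FR.≈⟨ F.*-congˡ (F.*-congˡ one-y) ⟩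
        ⟪ x ∣ c ⟫ * (value * 1#)                 FR.≈⟨ F.*-congˡ (F.*-identityʳ value) ⟩
        ⟪ x ∣ c ⟫ * value                        FR.≈⟨ F.*-comm _ value ⟩
        value * ⟪ x ∣ c ⟫                        FR.≈⟨ pair-· value x c ⟨
        ⟪ value · x ∣ c ⟫                        FR.∎

  endIsScalars : EndIsScalars algebra M
  endIsScalars f = mk⇔
    (λ hom → let open Endomorphism f hom in
      value , λ x → ≋-trans (f-scalar x) (≋-sym (ext-scalar value x)))
    (λ (a , f≋a) → scalar-isHomomorphism a f≋a)

  Γ-E : Γ≡ M κ E
  Γ-E = ChainInvariants.Γ≡-from-chain em κ reg chain E
    (λ α _ (β , α<β , ¬c) → decidable-stable em λ α∉E → ¬c (complemented α α∉E β α<β))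
    (λ α lim α∈E → suc⁺ α , <-suc⁺ , NonSplit.not-complemented α lim α∈E)

  stronglyUniform : StronglyUniform M
  stronglyUniform = κ , chain

  dimension : HasDimension M κ
  dimension = ChainInvariants.hasDimension em κ reg chain

theorem2p7 : (∀ {a} → ExcludedMiddle a) →
    (∀ {a b c d} → AxiomOfChoice a b c d) →
    ∀ {ℓ} (Λ : Ordinal ℓ) → IsCardinal Λ → IsUncountable Λ →
    (F : Field ℓ) →
    Σ[ R ∈ FAlgebra F ]
    ( (∀ (κ : Ordinal ℓ) → IsRegularUncountableCardinal κ → κ ≤ᶜ Λ →
    (E : Ordinal.Subset κ) →
    Σ[ L ∈ RightModule (FAlgebra.ring R) ℓ ℓ ]
    ( StronglyUniform L × HasDimension L κ
    × EndIsScalars R L × Γ≡ L κ E))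
    × (∀ (κ : Ordinal ℓ) → IsRegularUncountableCardinal κ → κ ≤ᶜ Λ →
    SpecΓ-Full κ (FAlgebra.ring R)))
theorem2p7 em _ {ℓ} Λ _ _ F = FreeAlgebra.algebra F J , realize , λ κ reg κ≤Λ E →
  let (L , uniform , dim , _ , Γ) = realize κ reg κ≤Λ E in L , uniform , dim , Γ
  where
  -- Words over Λ × Λ serve every κ ≤ Λ at once, through a retraction Λ → κ.
  A : Set ℓ
  A = Ordinal.Carrier Λ × Ordinal.Carrier Λ
  J : Set ℓ
  J = List A → FormalSums.L F (List A)
  realize : (κ : Ordinal ℓ) → IsRegularUncountableCardinal κ → κ ≤ᶜ Λ → (E : Ordinal.Subset κ) →
    Σ[ L ∈ RightModule (FreeAlgebra.ring F J) ℓ ℓ ]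
      (StronglyUniform L × HasDimension L κ × EndIsScalars (FreeAlgebra.algebra F J) L × Γ≡ L κ E)
  realize κ reg κ≤Λ E = C.M , C.stronglyUniform , C.dimension , C.endIsScalars , C.Γ-E
    where
    open Injection κ≤Λ using (to; injective)
    retract : Ordinal.Carrier Λ → Ordinal.Carrier κ
    retract l with em {P = ∃[ k ] to k ≡ l}
    ... | yes (k , _) = k
    -- Outside the image of `κ` any default works, since `letter` uses only elements `to δ` and
    -- `to ζ`.
    ... | no  _       = RegularCardinal.inhabitant em κ reg
    retract-to : ∀ k → retract (to k) ≡ k
    retract-to k with em {P = ∃[ k′ ] to k′ ≡ to k}
    ... | yes (k′ , eq) = injective eq
    ... | no  none      = contradiction (k , refl) none
    module C = Construction em F κ reg A (λ a → retract (proj₁ a)) (λ a → retract (proj₂ a))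
      (λ δ ζ → to δ , to ζ) (λ δ _ → retract-to δ) (λ _ ζ → retract-to ζ) E
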